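{- Set $P_0(x)=Q_0(x)=S_0(x)=T_0(x)=1$. Then for every integer $n\geq 0$, $$Q_n(x)=(1+2nx)P_n(x)+x(1-x)P_n'(x),$$ $$P_{n+1}(x)=(1+nx)Q_n(x)+\tfrac{1}{2}x(1-x)Q_n'(x),$$ and $$T_n(x)=(1+2nx)S_n(x)+x(1-x)S_n'(x),$$ $$S_{n+1}(x)=(1+3x+4nx)T_n(x)+2x(1-x)T_n'(x).$$
   Context: For $n\ge 1$: let $\mathcal{C}_n$ be the set of permutations (rearrangements) of the multiset $\{1,1,2,2,\ldots,n,n\}$ and $\mathfrak{D}_n$ the set of permutations of the multiset $\{1,1,2,2,\ldots,n,n,n+1\}$. For a word $\sigma=\sigma_1\cdots\sigma_m$, $\mathrm{des}(\sigma)=\#\{i\in\{1,\ldots,m-1\}:\sigma_i>\sigma_{i+1}\}$. Define $P_n(x)=\sum_{\sigma\in\mathcal{C}_n}x^{\mathrm{des}(\sigma)}$ and $Q_n(x)=\sum_{\sigma\in\mathfrak{D}_n}x^{\mathrm{des}(\sigma)}$. Let $\mathcal{C}_n^{\pm}$ be the set of all distinct signed permutations of the multiset $\{1,1,2,2,\ldots,n,n\}$, i.e. all words $\pm\sigma_1\pm\sigma_2\cdots\pm\sigma_{2n}$ with $\sigma_1\cdots\sigma_{2n}\in\mathcal{C}_n$ and each sign chosen arbitrarily. Let $\mathfrak{D}_n^{\pm}$ be the set of signed permutations of the multiset $\{1,1,2,2,\ldots,n,n,n+1\}$ in which the entry $n+1$ has a positive sign. For a signed word $\sigma=\sigma_1\cdots\sigma_m$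 set $\sigma_0=0$ and $\mathrm{des}_B(\sigma)=\#\{i\in\{0,1,\ldots,m-1\}:\sigma_i>\sigma_{i+1}\}$. Define $S_n(x)=\sum_{\sigma\in\mathcal{C}_n^{\pm}}x^{\mathrm{des}_B(\sigma)}$ and $T_n(x)=\sum_{\sigma\in\mathfrak{D}_n^{\pm}}x^{\mathrm{des}_B(\sigma)}$. Primes denote derivatives with respect to $x$. -}

module Defs where

open import Data.Nat.Base as ℕ using (ℕ; zero; suc)
import Data.Nat.Properties as ℕ
open import Data.Integer.Base as ℤ using (ℤ; +_; 0ℤ)
import Data.Integer.Properties as ℤ
open import Data.Rational.Base as ℚ using (ℚ; 0ℚ; 1ℚ)
open import Data.List.Base using (List; []; _∷_; [_]; _++_; map; foldr; length; replicate; filter; concatMap; deduplicate; cartesianProductWith)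
open import Data.List.Properties using (∷-injective)
open import Data.List.Membership.Propositional using (_∈_)
open import Data.List.Membership.Propositional.Properties using (∈-∃++; ∈-filter⁺; ∈-filter⁻; ∈-cartesianProductWith⁺; ∈-deduplicate⁺)
import Data.List.Membership.DecPropositional as DecMembership
open import Data.List.Relation.Unary.Any using (here; there)
open import Data.List.Relation.Unary.All as All using (All; []; _∷_)
open import Data.List.Relation.Unary.AllPairs using ([]; _∷_)
open import Data.List.Relation.Unary.Unique.Propositional using (Unique)
import Data.List.Relation.Unary.Unique.Propositional.Properties as Unique
open import Data.List.Relation.Unary.Unique.DecPropositional.Properties ℕ._≟_ using (deduplicate-!)
open import Data.List.Relation.Binary.Permutation.Propositional using (_↭_; ↭-refl; ↭-sym; ↭-trans; prep)
open import Data.List.Relation.Binary.Permutation.Propositional.Properties using (∈-resp-↭; drop-∷; shift; ↭-length; ¬x∷xs↭[])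
open import Data.Product.Base using (_,_; proj₂)
open import Function.Bundles using (_⇔_; mk⇔)
open import Level using (0ℓ)
open import Relation.Binary.Core using (Rel)
open import Relation.Binary.Definitions using (Decidable)
open import Relation.Binary.PropositionalEquality using (_≡_; refl; subst)
open import Relation.Nullary.Decidable using (yes; no; map′; ⌊_⌋)
open import Data.Bool.Base using (if_then_else_)

-- Polynomials over ℚ: coefficient lists, constant term first.  Trailing
-- zeros are allowed, so equality of polynomials is _≈_, not _≡_.

Poly : Set
Poly = List ℚ

coeff : Poly → ℕ → ℚ
coeff []      _       = 0ℚ
coeff (a ∷ _) zero    = a
coeff (_ ∷ p) (suc k) = coeff p k

infix 4 _≈_
_≈_ : Poly → Poly → Set
p ≈ q = ∀ k → coeff p k ≡ coeff q k

infixl 6 _+_ _-_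
infixl 7 _*_
infixr 8 _·_
infix  9 _′

_+_ : Poly → Poly → Poly
[]      + q       = q
(a ∷ p) + []      = a ∷ p
(a ∷ p) + (b ∷ q) = (a ℚ.+ b) ∷ (p + q)

_·_ : ℚ → Poly → Poly
c · p = map (c ℚ.*_) p

_-_ : Poly → Poly → Poly
p - q = p + (ℚ.- 1ℚ) · q

_*_ : Poly → Poly → Poly
[]      * q = []
(a ∷ p) * q = a · q + (0ℚ ∷ p * q)

fromℕ : ℕ → ℚ
fromℕ k = + k ℚ./ 1

const : ℕ → Poly
const k = [ fromℕ k ]

x^_ : ℕ → Poly
x^ k = replicate k 0ℚ ++ [ 1ℚ ]

x : Poly
x = x^ 1

-- scaleFrom k (a₀ ∷ a₁ ∷ a₂ ∷ …) = k a₀ ∷ (k+1) a₁ ∷ (k+2) a₂ ∷ …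
scaleFrom : ℕ → Poly → Poly
scaleFrom k []      = []
scaleFrom k (a ∷ p) = (fromℕ k ℚ.* a) ∷ scaleFrom (suc k) p

_′ : Poly → Poly
[]      ′ = []
(_ ∷ p) ′ = scaleFrom 1 p

∑x^ : {A : Set} → (A → ℕ) → List A → Poly
∑x^ stat S = foldr (λ σ p → x^ (stat σ) + p) [] S

_↭?_ : Decidable (_↭_ {A = ℕ})
[]      ↭? []      = yes ↭-refl
[]      ↭? (_ ∷ _) = no λ p → ¬x∷xs↭[] (↭-sym p)
(a ∷ v) ↭? w with DecMembership._∈?_ ℕ._≟_ a w
... | no  a∉w = no λ p → a∉w (∈-resp-↭ p (here refl))
... | yes a∈w with ∈-∃++ a∈w
...   | w₁ , w₂ , refl = map′
        (λ p → ↭-trans (prep a p) (↭-sym (shift a w₁ w₂)))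
        (λ p → drop-∷ (↭-trans p (shift a w₁ w₂)))
        (v ↭? (w₁ ++ w₂))

words : List ℕ → ℕ → List (List ℕ)
words A zero    = [ [] ]
words A (suc m) = cartesianProductWith _∷_ A (words A m)

-- The list M stands for a finite multiset.  Each distinct rearrangement of M is listed exactly once: see
-- ∈-rearrangements and rearrangements-unique.
rearrangements : List ℕ → List (List ℕ)
rearrangements M = filter (_↭? M) (words (deduplicate ℕ._≟_ M) (length M))

∈-words : ∀ {A} w → All (_∈ A) w → w ∈ words A (length w)
∈-words []      []         = here refl
∈-words (a ∷ w) (a∈ ∷ w∈) = ∈-cartesianProductWith⁺ _∷_ a∈ (∈-words w w∈)

words-unique : ∀ {A} → Unique A → ∀ m → Unique (words A m)
words-unique A! zero    = [] ∷ []
words-unique A! (suc m) = Unique.cartesianProductWith⁺ _∷_ ∷-injective A! (words-unique A! m)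

∈-rearrangements : ∀ M w → (w ∈ rearrangements M) ⇔ (w ↭ M)
∈-rearrangements M w = mk⇔
  (λ w∈ → proj₂ (∈-filter⁻ (_↭? M) {xs = words A (length M)} w∈))
  (λ p → ∈-filter⁺ (_↭? M)
    (subst (λ m → w ∈ words A m) (↭-length p)
      (∈-words w (All.tabulate λ a∈w → ∈-deduplicate⁺ ℕ._≟_ (∈-resp-↭ p a∈w))))
    p)
  where
  A = deduplicate ℕ._≟_ M

rearrangements-unique : ∀ M → Unique (rearrangements M)
rearrangements-unique M =
  Unique.filter⁺ (_↭? M) (words-unique (deduplicate-! M) (length M))

descents : {A : Set} {_<_ : Rel A 0ℓ} → Decidable _<_ → List A → ℕ
descents _<?_ []          = 0
descents _<?_ (_ ∷ [])    = 0
descents _<?_ (a ∷ b ∷ w) = (if ⌊ b <? a ⌋ then 1 else 0) ℕ.+ descents _<?_ (b ∷ w)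

des : List ℕ → ℕ
des = descents ℕ._<?_

desB : List ℤ → ℕ
desB w = descents ℤ._<?_ (0ℤ ∷ w)

-- {1,1,2,2,…,n,n} as a list; its order is immaterial.
doubled : ℕ → List ℕ
doubled zero    = []
doubled (suc n) = suc n ∷ suc n ∷ doubled n

𝒞 : ℕ → List (List ℕ)
𝒞 n = rearrangements (doubled n)

𝔇 : ℕ → List (List ℕ)
𝔇 n = rearrangements (suc n ∷ doubled n)

-- All ways of attaching signs to the letters of a word; these are pairwise
-- distinct when, as for words in 𝒞 n and 𝔇 n, every letter is nonzero.
signings : List ℕ → List (List ℤ)
signings []      = [ [] ]
signings (a ∷ w) = cartesianProductWith _∷_ (+ a ∷ ℤ.- (+ a) ∷ []) (signings w)

𝒞± : ℕ → List (List ℤ)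
𝒞± n = concatMap signings (𝒞 n)

-- The letter n+1 occurs exactly once up to sign, so membership of + (n+1)
-- says that it has positive sign.
𝔇± : ℕ → List (List ℤ)
𝔇± n = filter (λ w → DecMembership._∈?_ ℤ._≟_ (+ suc n) w) (concatMap signings (𝔇 n))

P Q S T : ℕ → Poly

P zero      = const 1
P n@(suc _) = ∑x^ des (𝒞 n)

Q zero      = const 1
Q n@(suc _) = ∑x^ des (𝔇 n)

S zero      = const 1
S n@(suc _) = ∑x^ desB (𝒞± n)

T zero      = const 1
T n@(suc _) = ∑x^ desB (𝔇± n)

{-# OPTIONS --safe #-}
module Submission where

-- Insert one letter a into a word w with d descents (a fixed letter c is put in front of w, c = 0 here).
-- No slot destroys a descent and each creates at most one; summing [a<c] + [b<a] − [b<c] over the slots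
-- (c,b) shows that exactly |w| − #ₐ(w) + [a<c] − d of the |w| + 1 slots create one.  Conversely, a word w
-- arises from #ₐ(w) pairs (shorter word, slot), so summing over all words of 𝒞 n or 𝔇 n gives P and Q.
-- For signed words, insert N = n+1 and −N simultaneously: the result depends on the total number of
-- letters ±N only, so it relates S n, S (n+1) and the sum over all signed words of 𝔇 n.  Inserting N
-- alone relates T n and S n, and both sides of the last identity become the same sum over 𝒞± n.
-- Polynomial identities are read off coefficientwise: the coefficient of x^k in a sum of x^des is the sum
-- of φ(des) for φ d = [d = k].

open import Defs
open import Data.Nat.Base as ℕ using (ℕ; zero; suc)
open import Data.Rational.Base as ℚ using (ℚ; 0ℚ; 1ℚ; ½)
open import Data.Product.Base using (_×_; _,_)
open import Algebra.Properties.CommutativeSemigroup using (interchange)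
open import Data.Bool.Base using (if_then_else_)
open import Data.Empty using (⊥-elim)
open import Data.Integer.Base as ℤ using (ℤ; +_; -[1+_]; 0ℤ; ∣_∣)
import Data.Integer.Properties as ℤ
open import Data.List.Base using (List; []; _∷_; [_]; _++_; map; foldr; length; filter; concatMap)
open import Data.List.Properties using (∷-injective; length-map)
import Data.List.Membership.DecPropositional as DecMembership
open import Data.List.Membership.Propositional using (_∈_; _∉_; find)
open import Data.List.Membership.Propositional.Properties using (∈-map⁻; ∈-concatMap⁺; ∈-concatMap⁻; ∈-cartesianProductWith⁺; ∈-cartesianProductWith⁻)
open import Data.List.Relation.Binary.Disjoint.Propositional using (Disjoint)
open import Data.List.Relation.Binary.Permutation.Propositional as ↭ using (_↭_; ↭-refl; ↭-trans; ↭-prep; ↭-swap)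
open import Data.List.Relation.Binary.Permutation.Propositional.Properties using (drop-∷; ↭-length; ∈-resp-↭) renaming (map⁺ to ↭-map⁺)
open import Data.List.Relation.Unary.All as All using (All; []; _∷_)
import Data.List.Relation.Unary.All.Properties as All
open import Data.List.Relation.Unary.AllPairs as AllPairs using ([]; _∷_)
import Data.List.Relation.Unary.AllPairs.Properties as AllPairs
open import Data.List.Relation.Unary.Any as Any using (here; there)
open import Data.List.Relation.Unary.Unique.Propositional using (Unique)
import Data.List.Relation.Unary.Unique.Propositional.Properties as Unique
import Data.Nat.Properties as ℕ
import Data.Rational.Properties as ℚ
open import Data.Rational.Solver using (module +-*-Solver)
open import Data.Rational.Unnormalised.Base as ℚᵘ using (mkℚᵘ; *≡*)
import Data.Rational.Unnormalised.Properties as ℚᵘ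
open import Data.Sum.Base using (_⊎_; inj₁; inj₂)
open import Function.Bundles using (_⇔_; mk⇔; Equivalence)
open import Level using (0ℓ)
open import Relation.Binary.Core using (Rel)
open import Relation.Binary.Definitions using (Decidable; DecidableEquality; tri<; tri≈; tri>)
open import Relation.Binary.PropositionalEquality using (_≡_; _≢_; refl; sym; trans; cong; cong₂; subst; module ≡-Reasoning)
open import Relation.Binary.Structures using (IsStrictTotalOrder)
open import Relation.Nullary.Decidable using (Dec; yes; no; ⌊_⌋)
open import Relation.Nullary.Negation using (¬_)
import Relation.Unary as Unary
open +-*-Solver using (solve; con; _:+_; _:*_; _:-_; :-_; _:=_)
open ≡-Reasoning
open Equivalence using (to; from)

-- Natural numbers as rationals

fromℕ-+ : ∀ m n → fromℕ (m ℕ.+ n) ≡ fromℕ m ℚ.+ fromℕ n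
-- Every `fromℕ` is normalised by a gcd; after passing to unnormalised fractions all denominators
-- are 1 and only the numerators need comparison.
fromℕ-+ m n = ℚ.toℚᵘ-injective (begin-equality
  ℚ.toℚᵘ (fromℕ (m ℕ.+ n))               ≃⟨ ℚ.toℚᵘ-fromℚᵘ (mkℚᵘ (+ (m ℕ.+ n)) 0) ⟩
  mkℚᵘ (+ (m ℕ.+ n)) 0                   ≃⟨ *≡* numerators ⟩
  mkℚᵘ (+ m) 0 ℚᵘ.+ mkℚᵘ (+ n) 0         ≃⟨ ℚᵘ.+-cong (ℚ.toℚᵘ-fromℚᵘ (mkℚᵘ (+ m) 0)) (ℚ.toℚᵘ-fromℚᵘ (mkℚᵘ (+ n) 0)) ⟨
  ℚ.toℚᵘ (fromℕ m) ℚᵘ.+ ℚ.toℚᵘ (fromℕ n) ≃⟨ ℚ.toℚᵘ-homo-+ (fromℕ m) (fromℕ n) ⟨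
  ℚ.toℚᵘ (fromℕ m ℚ.+ fromℕ n)           ∎′)
  where
  open ℚᵘ.≤-Reasoning using (begin-equality_; step-≃-⟩; step-≃-⟨) renaming (_∎ to _∎′)
  numerators : + (m ℕ.+ n) ℤ.* + 1 ≡ (+ m ℤ.* + 1 ℤ.+ + n ℤ.* + 1) ℤ.* + 1
  numerators = cong (ℤ._* + 1) (sym (cong₂ ℤ._+_ (ℤ.*-identityʳ (+ m)) (ℤ.*-identityʳ (+ n))))

-- Unlike fromℕ, whose unfolding involves a gcd, ♯ reduces well on open terms.
♯ : ℕ → ℚ
♯ zero    = 0ℚ
♯ (suc n) = 1ℚ ℚ.+ ♯ n

♯-+ : ∀ m n → ♯ (m ℕ.+ n) ≡ ♯ m ℚ.+ ♯ n
♯-+ zero    n = sym (ℚ.+-identityˡ (♯ n))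
♯-+ (suc m) n = trans (cong (1ℚ ℚ.+_) (♯-+ m n)) (sym (ℚ.+-assoc 1ℚ (♯ m) (♯ n)))

fromℕ≡♯ : ∀ n → fromℕ n ≡ ♯ n
fromℕ≡♯ zero    = refl
fromℕ≡♯ (suc n) = trans (fromℕ-+ 1 n) (cong (1ℚ ℚ.+_) (fromℕ≡♯ n))

private
  variable
    A B : Set

-- The Iverson bracket, in the same `if` form as in `descents`, so that the summands of `descents`
-- are values of `ι` by definition.
ι : Dec A → ℕ
ι A? = if ⌊ A? ⌋ then 1 else 0

ι-yes : (A? : Dec A) → A → ι A? ≡ 1
ι-yes (yes _) _ = refl
ι-yes (no ¬a) a = ⊥-elim (¬a a)

ι-no : (A? : Dec A) → ¬ A → ι A? ≡ 0
ι-no (yes a) ¬a = ⊥-elim (¬a a)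
ι-no (no _)  _  = refl

-- Finite sums

∑ : (A → ℚ) → List A → ℚ
∑ f = foldr (λ a s → f a ℚ.+ s) 0ℚ

∑-cong : {f g : A → ℚ} (L : List A) → (∀ {a} → a ∈ L → f a ≡ g a) → ∑ f L ≡ ∑ g L
∑-cong []      f≗g = refl
∑-cong (a ∷ L) f≗g = cong₂ ℚ._+_ (f≗g (here refl)) (∑-cong L (λ a∈L → f≗g (there a∈L)))

∑-0 : (L : List A) → ∑ (λ _ → 0ℚ) L ≡ 0ℚ
∑-0 []      = refl
∑-0 (a ∷ L) = trans (ℚ.+-identityˡ _) (∑-0 L)

∑-+ : (f g : A → ℚ) (L : List A) → ∑ (λ a → f a ℚ.+ g a) L ≡ ∑ f L ℚ.+ ∑ g L
∑-+ f g []      = refl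
∑-+ f g (a ∷ L) rewrite ∑-+ f g L =
  solve 4 (λ p q r s → (p :+ q) :+ (r :+ s) := (p :+ r) :+ (q :+ s)) refl (f a) (g a) (∑ f L) (∑ g L)

∑-* : (c : ℚ) (f : A → ℚ) (L : List A) → ∑ (λ a → c ℚ.* f a) L ≡ c ℚ.* ∑ f L
∑-* c f []      = sym (ℚ.*-zeroʳ c)
∑-* c f (a ∷ L) rewrite ∑-* c f L = sym (ℚ.*-distribˡ-+ c (f a) (∑ f L))

∑-map : (f : A → ℚ) (g : B → A) (L : List B) → ∑ f (map g L) ≡ ∑ (λ b → f (g b)) L
∑-map f g []      = refl
∑-map f g (b ∷ L) = cong (f (g b) ℚ.+_) (∑-map f g L)

∑-swap : (f : A → B → ℚ) (L : List A) (L′ : List B) →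
         ∑ (λ a → ∑ (f a) L′) L ≡ ∑ (λ b → ∑ (λ a → f a b) L) L′
∑-swap f []      L′ = sym (∑-0 L′)
∑-swap f (a ∷ L) L′ rewrite ∑-swap f L L′ = sym (∑-+ (f a) (λ b → ∑ (λ a′ → f a′ b) L) L′)

∑-filter : {C : A → Set} (C? : Unary.Decidable C) (f : A → ℚ) (L : List A) →
           ∑ f (filter C? L) ≡ ∑ (λ a → ♯ (ι (C? a)) ℚ.* f a) L
∑-filter C? f []      = refl
∑-filter C? f (a ∷ L) with C? a
... | yes _ = cong₂ ℚ._+_ (sym (ℚ.*-identityˡ (f a))) (∑-filter C? f L)
... | no _  = trans (∑-filter C? f L) (sym (trans (cong (ℚ._+ ∑ (λ a → ♯ (ι (C? a)) ℚ.* f a) L) (ℚ.*-zeroˡ (f a))) (ℚ.+-identityˡ _)))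

-- Dual to p ↦ (a + b x) p + e x (1 − x) p′, which maps x^d to (a + e d) x^d + (b − e d) x^(d+1).
adjoint : (a b e : ℚ) → (ℕ → ℚ) → ℕ → ℚ
adjoint a b e φ d = (a ℚ.+ e ℚ.* ♯ d) ℚ.* φ d ℚ.+ (b ℚ.- e ℚ.* ♯ d) ℚ.* φ (suc d)

adjoint-* : ∀ c a b e φ d → c ℚ.* adjoint a b e φ d ≡ adjoint (c ℚ.* a) (c ℚ.* b) (c ℚ.* e) φ d
adjoint-* c a b e φ d = solve 7 (λ c a b e d p q →
  c :* ((a :+ e :* d) :* p :+ (b :- e :* d) :* q) :=
  (c :* a :+ c :* e :* d) :* p :+ (c :* b :- c :* e :* d) :* q)
  refl c a b e (♯ d) (φ d) (φ (suc d))

adjoint-+ : ∀ a b e a′ b′ e′ φ d →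
  adjoint a b e φ d ℚ.+ adjoint a′ b′ e′ φ d ≡ adjoint (a ℚ.+ a′) (b ℚ.+ b′) (e ℚ.+ e′) φ d
adjoint-+ a b e a′ b′ e′ φ d = solve 9 (λ a b e a′ b′ e′ d p q →
  ((a :+ e :* d) :* p :+ (b :- e :* d) :* q) :+ ((a′ :+ e′ :* d) :* p :+ (b′ :- e′ :* d) :* q) :=
  ((a :+ a′) :+ (e :+ e′) :* d) :* p :+ ((b :+ b′) :- (e :+ e′) :* d) :* q)
  refl a b e a′ b′ e′ (♯ d) (φ d) (φ (suc d))

adjoint-cong : ∀ {a a′ b b′} e φ d → a ≡ a′ → b ≡ b′ → adjoint a b e φ d ≡ adjoint a′ b′ e φ d
adjoint-cong e φ d refl refl = refl

-- Coefficients

coeff-+ : ∀ p q k → coeff (p + q) k ≡ coeff p k ℚ.+ coeff q k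
coeff-+ []      q       k       = sym (ℚ.+-identityˡ (coeff q k))
coeff-+ (a ∷ p) []      k       = sym (ℚ.+-identityʳ (coeff (a ∷ p) k))
coeff-+ (a ∷ p) (b ∷ q) zero    = refl
coeff-+ (a ∷ p) (b ∷ q) (suc k) = coeff-+ p q k

coeff-· : ∀ c p k → coeff (c · p) k ≡ c ℚ.* coeff p k
coeff-· c []      k       = sym (ℚ.*-zeroʳ c)
coeff-· c (a ∷ p) zero    = refl
coeff-· c (a ∷ p) (suc k) = coeff-· c p k

coeff-∷* : ∀ a p q k → coeff ((a ∷ p) * q) k ≡ a ℚ.* coeff q k ℚ.+ coeff (0ℚ ∷ p * q) k
coeff-∷* a p q k = trans (coeff-+ (a · q) (0ℚ ∷ p * q) k) (cong (ℚ._+ coeff (0ℚ ∷ p * q) k) (coeff-· a q k))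

coeff-0∷[] : ∀ k → coeff (0ℚ ∷ []) k ≡ 0ℚ
coeff-0∷[] zero    = refl
coeff-0∷[] (suc _) = refl

coeff-scaleFrom : ∀ j p k → coeff (scaleFrom j p) k ≡ ♯ (j ℕ.+ k) ℚ.* coeff p k
coeff-scaleFrom j []      k       = sym (ℚ.*-zeroʳ (♯ (j ℕ.+ k)))
coeff-scaleFrom j (a ∷ p) zero    = cong (ℚ._* a) (trans (fromℕ≡♯ j) (cong ♯ (sym (ℕ.+-identityʳ j))))
coeff-scaleFrom j (a ∷ p) (suc k) = trans (coeff-scaleFrom (suc j) p k) (cong (λ i → ♯ i ℚ.* coeff p k) (sym (ℕ.+-suc j k)))

coeff-′ : ∀ p k → coeff (p ′) k ≡ ♯ (suc k) ℚ.* coeff p (suc k)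
coeff-′ []      k = sym (ℚ.*-zeroʳ (♯ (suc k)))
coeff-′ (_ ∷ p) k = coeff-scaleFrom 1 p k

coeff-linear* : ∀ a b p k → coeff ((a ∷ b ∷ []) * p) k ≡ a ℚ.* coeff p k ℚ.+ b ℚ.* coeff (0ℚ ∷ p) k
coeff-linear* a b p zero    = trans (coeff-∷* a (b ∷ []) p 0) (cong (a ℚ.* coeff p 0 ℚ.+_) (sym (ℚ.*-zeroʳ b)))
coeff-linear* a b p (suc k) = begin
  coeff ((a ∷ b ∷ []) * p) (suc k)                                 ≡⟨ coeff-∷* a (b ∷ []) p (suc k) ⟩
  a ℚ.* coeff p (suc k) ℚ.+ coeff ((b ∷ []) * p) k                 ≡⟨ cong (a ℚ.* coeff p (suc k) ℚ.+_) (coeff-∷* b [] p k) ⟩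
  a ℚ.* coeff p (suc k) ℚ.+ (b ℚ.* coeff p k ℚ.+ coeff (0ℚ ∷ []) k) ≡⟨ cong (λ z → a ℚ.* coeff p (suc k) ℚ.+ (b ℚ.* coeff p k ℚ.+ z)) (coeff-0∷[] k) ⟩
  a ℚ.* coeff p (suc k) ℚ.+ (b ℚ.* coeff p k ℚ.+ 0ℚ)               ≡⟨ cong (a ℚ.* coeff p (suc k) ℚ.+_) (ℚ.+-identityʳ _) ⟩
  a ℚ.* coeff p (suc k) ℚ.+ b ℚ.* coeff p k                        ∎

-- The Euler operator x d/dx on coefficients: multiplication by x undoes the index shift of the
-- derivative.
coeff-0∷′ : ∀ p k → coeff (0ℚ ∷ p ′) k ≡ ♯ k ℚ.* coeff p k
coeff-0∷′ p zero    = sym (ℚ.*-zeroˡ (coeff p 0))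
coeff-0∷′ p (suc k) = coeff-′ p k

coeff-x[1-x]*′-suc : ∀ e p k → coeff ((0ℚ ∷ e ∷ ℚ.- e ∷ []) * p ′) (suc k) ≡
  e ℚ.* (♯ (suc k) ℚ.* coeff p (suc k)) ℚ.- e ℚ.* (♯ k ℚ.* coeff p k)
coeff-x[1-x]*′-suc e p k = begin
  coeff ((0ℚ ∷ e ∷ ℚ.- e ∷ []) * p ′) (suc k)
    ≡⟨ coeff-∷* 0ℚ (e ∷ ℚ.- e ∷ []) (p ′) (suc k) ⟩
  0ℚ ℚ.* coeff (p ′) (suc k) ℚ.+ coeff ((e ∷ ℚ.- e ∷ []) * p ′) k
    ≡⟨ cong₂ ℚ._+_ (ℚ.*-zeroˡ (coeff (p ′) (suc k))) (coeff-linear* e (ℚ.- e) (p ′) k) ⟩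
  0ℚ ℚ.+ (e ℚ.* coeff (p ′) k ℚ.+ (ℚ.- e) ℚ.* coeff (0ℚ ∷ p ′) k)
    ≡⟨ cong₂ (λ y z → 0ℚ ℚ.+ (e ℚ.* y ℚ.+ (ℚ.- e) ℚ.* z)) (coeff-′ p k) (coeff-0∷′ p k) ⟩
  0ℚ ℚ.+ (e ℚ.* (♯ (suc k) ℚ.* coeff p (suc k)) ℚ.+ (ℚ.- e) ℚ.* (♯ k ℚ.* coeff p k))
    ≡⟨ solve 3 (λ e y z → con 0ℚ :+ (e :* y :+ (:- e) :* z) := e :* y :- e :* z) refl e (♯ (suc k) ℚ.* coeff p (suc k)) (♯ k ℚ.* coeff p k) ⟩
  e ℚ.* (♯ (suc k) ℚ.* coeff p (suc k)) ℚ.- e ℚ.* (♯ k ℚ.* coeff p k) ∎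

coeff-∑x^ : (stat : A → ℕ) (L : List A) → ∀ k → coeff (∑x^ stat L) k ≡ ∑ (λ σ → coeff (x^ stat σ) k) L
coeff-∑x^ stat []      k = refl
coeff-∑x^ stat (σ ∷ L) k = trans (coeff-+ (x^ stat σ) (∑x^ stat L) k) (cong (coeff (x^ stat σ) k ℚ.+_) (coeff-∑x^ stat L k))

-- The coefficient vanishes unless k = d. This trades the factor k produced by differentiation for
-- the statistic of the word.
♯*coeff-x^ : ∀ d k → ♯ k ℚ.* coeff (x^ d) k ≡ ♯ d ℚ.* coeff (x^ d) k
♯*coeff-x^ zero    zero    = refl
♯*coeff-x^ zero    (suc k) = trans (ℚ.*-zeroʳ (♯ (suc k))) (sym (ℚ.*-zeroˡ 0ℚ))
♯*coeff-x^ (suc d) zero    = trans (ℚ.*-zeroʳ (♯ zero)) (sym (ℚ.*-zeroʳ (♯ (suc d))))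
♯*coeff-x^ (suc d) (suc k) = begin
  (1ℚ ℚ.+ ♯ k) ℚ.* c       ≡⟨ ℚ.*-distribʳ-+ c 1ℚ (♯ k) ⟩
  1ℚ ℚ.* c ℚ.+ ♯ k ℚ.* c   ≡⟨ cong (1ℚ ℚ.* c ℚ.+_) (♯*coeff-x^ d k) ⟩
  1ℚ ℚ.* c ℚ.+ ♯ d ℚ.* c   ≡⟨ ℚ.*-distribʳ-+ c 1ℚ (♯ d) ⟨
  (1ℚ ℚ.+ ♯ d) ℚ.* c       ∎
  where c = coeff (x^ d) k

♯*coeff-∑x^ : (stat : A → ℕ) (L : List A) → ∀ k →
  ♯ k ℚ.* coeff (∑x^ stat L) k ≡ ∑ (λ σ → ♯ (stat σ) ℚ.* coeff (x^ stat σ) k) L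
♯*coeff-∑x^ stat L k = begin
  ♯ k ℚ.* coeff (∑x^ stat L) k                      ≡⟨ cong (♯ k ℚ.*_) (coeff-∑x^ stat L k) ⟩
  ♯ k ℚ.* ∑ (λ σ → coeff (x^ stat σ) k) L           ≡⟨ ∑-* (♯ k) (λ σ → coeff (x^ stat σ) k) L ⟨
  ∑ (λ σ → ♯ k ℚ.* coeff (x^ stat σ) k) L           ≡⟨ ∑-cong L (λ {σ} _ → ♯*coeff-x^ (stat σ) k) ⟩
  ∑ (λ σ → ♯ (stat σ) ℚ.* coeff (x^ stat σ) k) L    ∎

-- The duality behind `adjoint`: the operator is linear, so it suffices to follow each monomial x^d,
-- with test function φ d = [d = k]. The list `0ℚ ∷ e ∷ ℚ.- e ∷ []` is e x (1 - x).
coeff-adjoint : ∀ a b e (stat : A → ℕ) (L : List A) k →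
  coeff ((a ∷ b ∷ []) * ∑x^ stat L + (0ℚ ∷ e ∷ ℚ.- e ∷ []) * (∑x^ stat L) ′) k ≡
  ∑ (λ σ → adjoint a b e (λ d → coeff (x^ d) k) (stat σ)) L
coeff-adjoint {A} a b e stat L k = begin
  coeff ((a ∷ b ∷ []) * p + (0ℚ ∷ e ∷ ℚ.- e ∷ []) * p ′) k
    ≡⟨ coeff-+ ((a ∷ b ∷ []) * p) ((0ℚ ∷ e ∷ ℚ.- e ∷ []) * p ′) k ⟩
  coeff ((a ∷ b ∷ []) * p) k ℚ.+ coeff ((0ℚ ∷ e ∷ ℚ.- e ∷ []) * p ′) k
    ≡⟨ cong₂ ℚ._+_ (coeff-linear* a b p k) (derivative-part k) ⟩
  (a ℚ.* coeff p k ℚ.+ b ℚ.* coeff (0ℚ ∷ p) k) ℚ.+ (e ℚ.* ∑ (λ σ → D σ ℚ.* φ k σ) L ℚ.- e ℚ.* ∑ (λ σ → D σ ℚ.* φ′ k σ) L)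
    ≡⟨ cong₂ (λ y z → (a ℚ.* y ℚ.+ b ℚ.* z) ℚ.+ (e ℚ.* ∑ (λ σ → D σ ℚ.* φ k σ) L ℚ.- e ℚ.* ∑ (λ σ → D σ ℚ.* φ′ k σ) L)) (coeff-∑x^ stat L k) (shifted k) ⟩
  (a ℚ.* ∑ (φ k) L ℚ.+ b ℚ.* ∑ (φ′ k) L) ℚ.+ (e ℚ.* ∑ (λ σ → D σ ℚ.* φ k σ) L ℚ.- e ℚ.* ∑ (λ σ → D σ ℚ.* φ′ k σ) L)
    ≡⟨ combine L ⟩
  ∑ (λ σ → (a ℚ.+ e ℚ.* D σ) ℚ.* φ k σ ℚ.+ (b ℚ.- e ℚ.* D σ) ℚ.* φ′ k σ) L ∎
  where
  p = ∑x^ stat L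
  D : A → ℚ
  D σ = ♯ (stat σ)
  φ φ′ : ℕ → A → ℚ
  φ k σ = coeff (x^ stat σ) k
  φ′ k σ = coeff (x^ suc (stat σ)) k

  shifted : ∀ k → coeff (0ℚ ∷ p) k ≡ ∑ (φ′ k) L
  -- No monomial x^(d+1) has a constant term, so every summand is 0.
  shifted zero    = sym (∑-0 L)
  shifted (suc k) = coeff-∑x^ stat L k

  derivative-part : ∀ k → coeff ((0ℚ ∷ e ∷ ℚ.- e ∷ []) * p ′) k ≡
    e ℚ.* ∑ (λ σ → D σ ℚ.* φ k σ) L ℚ.- e ℚ.* ∑ (λ σ → D σ ℚ.* φ′ k σ) L
  derivative-part zero = begin
    coeff ((0ℚ ∷ e ∷ ℚ.- e ∷ []) * p ′) 0
      ≡⟨ coeff-∷* 0ℚ (e ∷ ℚ.- e ∷ []) (p ′) 0 ⟩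
    0ℚ ℚ.* coeff (p ′) 0 ℚ.+ 0ℚ
      ≡⟨ solve 3 (λ y z e → con 0ℚ :* y :+ con 0ℚ := e :* (con 0ℚ :* z) :- e :* con 0ℚ) refl (coeff (p ′) 0) (coeff p 0) e ⟩
    e ℚ.* (♯ 0 ℚ.* coeff p 0) ℚ.- e ℚ.* 0ℚ
      ≡⟨ cong₂ (λ y z → e ℚ.* y ℚ.- e ℚ.* z) (♯*coeff-∑x^ stat L 0)
           (sym (trans (∑-cong L (λ {σ} _ → ℚ.*-zeroʳ (D σ))) (∑-0 L))) ⟩
    e ℚ.* ∑ (λ σ → D σ ℚ.* φ 0 σ) L ℚ.- e ℚ.* ∑ (λ σ → D σ ℚ.* φ′ 0 σ) L ∎
  derivative-part (suc k) = trans (coeff-x[1-x]*′-suc e p k)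
    (cong₂ (λ y z → e ℚ.* y ℚ.- e ℚ.* z) (♯*coeff-∑x^ stat L (suc k)) (♯*coeff-∑x^ stat L k))

  combine : ∀ L → (a ℚ.* ∑ (φ k) L ℚ.+ b ℚ.* ∑ (φ′ k) L) ℚ.+ (e ℚ.* ∑ (λ σ → D σ ℚ.* φ k σ) L ℚ.- e ℚ.* ∑ (λ σ → D σ ℚ.* φ′ k σ) L)
    ≡ ∑ (λ σ → (a ℚ.+ e ℚ.* D σ) ℚ.* φ k σ ℚ.+ (b ℚ.- e ℚ.* D σ) ℚ.* φ′ k σ) L
  combine []      = solve 3 (λ a b e → (a :* con 0ℚ :+ b :* con 0ℚ) :+ (e :* con 0ℚ :- e :* con 0ℚ) := con 0ℚ) refl a b e
  combine (σ ∷ L) = trans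
    (solve 10 (λ a b e d p q P Q R S →
      (a :* (p :+ P) :+ b :* (q :+ Q)) :+ (e :* (d :* p :+ R) :- e :* (d :* q :+ S)) :=
      ((a :+ e :* d) :* p :+ (b :- e :* d) :* q) :+ ((a :* P :+ b :* Q) :+ (e :* R :- e :* S)))
      refl a b e (D σ) (φ k σ) (φ′ k σ) (∑ (φ k) L) (∑ (φ′ k) L) (∑ (λ σ → D σ ℚ.* φ k σ) L) (∑ (λ σ → D σ ℚ.* φ′ k σ) L))
    (cong (((a ℚ.+ e ℚ.* D σ) ℚ.* φ k σ ℚ.+ (b ℚ.- e ℚ.* D σ) ℚ.* φ′ k σ) ℚ.+_) (combine L))

coeff-·* : ∀ c p q k → coeff (c · (p * q)) k ≡ coeff ((c · p) * q) k
coeff-·* c []      q k = refl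
coeff-·* c (a ∷ p) q k = begin
  coeff (c · ((a ∷ p) * q)) k                              ≡⟨ coeff-· c ((a ∷ p) * q) k ⟩
  c ℚ.* coeff ((a ∷ p) * q) k                              ≡⟨ cong (c ℚ.*_) (coeff-∷* a p q k) ⟩
  c ℚ.* (a ℚ.* coeff q k ℚ.+ coeff (0ℚ ∷ p * q) k)         ≡⟨ solve 4 (λ c a y z → c :* (a :* y :+ z) := (c :* a) :* y :+ c :* z) refl c a (coeff q k) (coeff (0ℚ ∷ p * q) k) ⟩
  (c ℚ.* a) ℚ.* coeff q k ℚ.+ c ℚ.* coeff (0ℚ ∷ p * q) k   ≡⟨ cong ((c ℚ.* a) ℚ.* coeff q k ℚ.+_) (tail k) ⟩
  (c ℚ.* a) ℚ.* coeff q k ℚ.+ coeff (0ℚ ∷ (c · p) * q) k   ≡⟨ coeff-∷* (c ℚ.* a) (c · p) q k ⟨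
  coeff ((c · (a ∷ p)) * q) k                              ∎
  where
  tail : ∀ k → c ℚ.* coeff (0ℚ ∷ p * q) k ≡ coeff (0ℚ ∷ (c · p) * q) k
  tail zero    = ℚ.*-zeroʳ c
  tail (suc k) = trans (sym (coeff-· c (p * q) k)) (coeff-·* c p q k)

-- An identity of sums for every test function φ implies the polynomial identity. The equations are
-- arguments because P, Q, S, T are defined by cases on n, and because the factors of the theorem
-- must first be brought to explicit coefficient lists.
∑x^-recurrence : ∀ a b e (s : A → ℕ) (L : List A) (t : B → ℕ) (L′ : List B) →
  (∀ φ → ∑ (λ σ → φ (s σ)) L ≡ ∑ (λ τ → adjoint a b e φ (t τ)) L′) →
  ∀ {f g p q} → f ≡ ∑x^ s L → g ≡ ∑x^ t L′ → p ≡ a ∷ b ∷ [] → q ≡ 0ℚ ∷ e ∷ ℚ.- e ∷ [] →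
  f ≈ p * g + q * g ′
∑x^-recurrence a b e s L t L′ hyp refl refl refl refl k =
  trans (coeff-∑x^ s L k) (trans (hyp (λ d → coeff (x^ d) k)) (sym (coeff-adjoint a b e t L′ k)))

-- Insertions and deletions of a letter

-- One entry per slot: a word that arises from several slots is listed once for each of them.
insertions : A → List A → List (List A)
insertions a []      = [ [ a ] ]
insertions a (b ∷ w) = (a ∷ b ∷ w) ∷ map (b ∷_) (insertions a w)

insertions-↭ : {a : A} (w : List A) {u : List A} → u ∈ insertions a w → u ↭ a ∷ w
insertions-↭ []      (here refl) = ↭-refl
insertions-↭ (b ∷ w) (here refl) = ↭-refl
insertions-↭ (b ∷ w) (there u∈) with ∈-map⁻ (b ∷_) u∈
... | u′ , u′∈ , refl = ↭-trans (↭-prep b (insertions-↭ w u′∈)) (↭-swap b _ ↭-refl)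

module Occurrences {A : Set} (_≟_ : DecidableEquality A) where

  open DecMembership _≟_ using (_∈?_)

  deletions : A → List A → List (List A)
  deletions a []      = []
  deletions a (b ∷ w) = (if ⌊ b ≟ a ⌋ then [ w ] else []) ++ map (b ∷_) (deletions a w)

  count : A → List A → ℕ
  count a []      = 0
  count a (b ∷ w) = ι (b ≟ a) ℕ.+ count a w

  deletions-↭ : ∀ {a} w {v} → v ∈ deletions a w → a ∷ v ↭ w
  deletions-↭ {a} (b ∷ w) v∈ with b ≟ a
  deletions-↭ (b ∷ w) (here refl) | yes refl = ↭-refl
  deletions-↭ (b ∷ w) (there v∈)  | yes refl with ∈-map⁻ (b ∷_) v∈
  ... | v′ , v′∈ , refl = ↭-prep b (deletions-↭ w v′∈)
  deletions-↭ (b ∷ w) v∈          | no _ with ∈-map⁻ (b ∷_) v∈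
  ... | v′ , v′∈ , refl = ↭-trans (↭-swap _ b ↭-refl) (↭-prep b (deletions-↭ w v′∈))

  count-↭ : ∀ a {v w} → v ↭ w → count a v ≡ count a w
  count-↭ a ↭.refl       = refl
  count-↭ a (↭.prep b p) = cong (ι (b ≟ a) ℕ.+_) (count-↭ a p)
  count-↭ a {_} {_ ∷ _ ∷ w} (↭.swap b c p)
    rewrite count-↭ a p
          | sym (ℕ.+-assoc (ι (b ≟ a)) (ι (c ≟ a)) (count a w))
          | ℕ.+-comm (ι (b ≟ a)) (ι (c ≟ a))
          | ℕ.+-assoc (ι (c ≟ a)) (ι (b ≟ a)) (count a w) = refl
  count-↭ a (↭.trans p q) = trans (count-↭ a p) (count-↭ a q)

  count-∉ : ∀ {a} w → a ∉ w → count a w ≡ 0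
  count-∉ []          a∉w = refl
  count-∉ {a} (b ∷ w) a∉w
    rewrite ι-no (b ≟ a) (λ b≡a → a∉w (here (sym b≡a))) = count-∉ w (λ a∈w → a∉w (there a∈w))

  count-∈ : ∀ {a w} → a ∈ w → 1 ℕ.≤ count a w
  count-∈ {a} (here refl) rewrite ι-yes (a ≟ a) refl = ℕ.s≤s ℕ.z≤n
  count-∈ {a} {b ∷ w} (there a∈w) = ℕ.≤-trans (count-∈ a∈w) (ℕ.m≤n+m (count a w) (ι (b ≟ a)))

  -- Lets a filter by membership be replaced by the weight `count a w`, the weight that double
  -- counting produces.
  count≤1⇒count≡ι : ∀ {a} w → count a w ℕ.≤ 1 → count a w ≡ ι (a ∈? w)
  count≤1⇒count≡ι {a} w ≤1 with a ∈? w
  ... | yes a∈w = ℕ.≤-antisym ≤1 (count-∈ a∈w)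
  ... | no a∉w  = count-∉ w a∉w

  -- Kronecker delta on words and double counting

  δ₁ : A → A → ℚ
  δ₁ a b = ♯ (ι (a ≟ b))

  δ₁-sym : ∀ a b → δ₁ a b ≡ δ₁ b a
  δ₁-sym a b with a ≟ b
  ... | yes refl = cong ♯ (sym (ι-yes (b ≟ b) refl))
  ... | no a≢b   = cong ♯ (sym (ι-no (b ≟ a) (λ b≡a → a≢b (sym b≡a))))

  -- The indicator of equality as a product over letters, so that a common first letter factors out
  -- of sums over `insertions` and `deletions`.
  δ : List A → List A → ℚ
  δ []      []      = 1ℚ
  δ (a ∷ v) (b ∷ w) = δ₁ a b ℚ.* δ v w
  δ _       _       = 0ℚ

  δ-sym : ∀ v w → δ v w ≡ δ w v
  δ-sym []      []      = refl
  δ-sym []      (_ ∷ _) = refl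
  δ-sym (_ ∷ _) []      = refl
  δ-sym (a ∷ v) (b ∷ w) = cong₂ ℚ._*_ (δ₁-sym a b) (δ-sym v w)

  δ-refl : ∀ w → δ w w ≡ 1ℚ
  δ-refl []      = refl
  δ-refl (a ∷ w) rewrite ι-yes (a ≟ a) refl | δ-refl w = refl

  δ-≢ : ∀ v w → v ≢ w → δ v w ≡ 0ℚ
  δ-≢ []      []      v≢w = ⊥-elim (v≢w refl)
  δ-≢ []      (_ ∷ _) v≢w = refl
  δ-≢ (_ ∷ _) []      v≢w = refl
  δ-≢ (a ∷ v) (b ∷ w) v≢w with a ≟ b
  ... | yes refl rewrite δ-≢ v w (λ v≡w → v≢w (cong (a ∷_) v≡w)) = refl
  ... | no _ = ℚ.*-zeroˡ (δ v w)

  ∑-δ-∉ : ∀ u (φ : List A → ℚ) R → All (u ≢_) R → ∑ (λ w → δ u w ℚ.* φ w) R ≡ 0ℚ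
  ∑-δ-∉ u φ []      []          = refl
  ∑-δ-∉ u φ (w ∷ R) (u≢w ∷ u∉R)
    rewrite δ-≢ u w u≢w | ∑-δ-∉ u φ R u∉R | ℚ.*-zeroˡ (φ w) = refl

  ∑-δ : ∀ {u} (φ : List A → ℚ) {R} → Unique R → u ∈ R → ∑ (λ w → δ u w ℚ.* φ w) R ≡ φ u
  ∑-δ {u} φ (u∉R ∷ R!) (here refl)
    rewrite δ-refl u | ∑-δ-∉ u φ _ u∉R = trans (ℚ.+-identityʳ _) (ℚ.*-identityˡ (φ u))
  ∑-δ {u} φ {w ∷ _} (w∉R ∷ R!) (there u∈R)
    rewrite δ-≢ u w (λ u≡w → All.lookup w∉R u∈R (sym u≡w)) | ∑-δ φ R! u∈R | ℚ.*-zeroˡ (φ w) = ℚ.+-identityˡ (φ u)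

  -- A Leibniz rule: either the first letter is deleted, provided it is a, or the deletion takes
  -- place behind it.
  ∑-deletions-∷ : ∀ (f : List A → ℚ) a b w →
    ∑ f (deletions a (b ∷ w)) ≡ δ₁ a b ℚ.* f w ℚ.+ ∑ (λ v → f (b ∷ v)) (deletions a w)
  ∑-deletions-∷ f a b w rewrite δ₁-sym a b | sym (∑-map f (b ∷_) (deletions a w)) with b ≟ a
  ... | yes _ = cong (ℚ._+ ∑ f (map (b ∷_) (deletions a w))) (sym (ℚ.*-identityˡ (f w)))
  ... | no _  = sym (trans (cong (ℚ._+ ∑ f (map (b ∷_) (deletions a w))) (ℚ.*-zeroˡ (f w))) (ℚ.+-identityˡ _))

  ∑-deletions-1 : ∀ a w → ∑ (λ _ → 1ℚ) (deletions a w) ≡ ♯ (count a w)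
  ∑-deletions-1 a []      = refl
  ∑-deletions-1 a (b ∷ w) = begin
    ∑ (λ _ → 1ℚ) (deletions a (b ∷ w))                      ≡⟨ ∑-deletions-∷ (λ _ → 1ℚ) a b w ⟩
    δ₁ a b ℚ.* 1ℚ ℚ.+ ∑ (λ _ → 1ℚ) (deletions a w)          ≡⟨ cong₂ ℚ._+_ (trans (ℚ.*-identityʳ (δ₁ a b)) (δ₁-sym a b)) (∑-deletions-1 a w) ⟩
    ♯ (ι (b ≟ a)) ℚ.+ ♯ (count a w)                         ≡⟨ ♯-+ (ι (b ≟ a)) (count a w) ⟨
    ♯ (count a (b ∷ w))                                     ∎

  -- Insertion and deletion of a are transposes of each other. Inserting in front of v matches
  -- deleting the first letter of w; in all other cases the first letters must agree, and induction
  -- applies behind them.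
  insertions-deletions : ∀ a v w → ∑ (λ u → δ u w) (insertions a v) ≡ ∑ (δ v) (deletions a w)
  insertions-deletions a []      []      = refl
  insertions-deletions a (c ∷ v) []
    rewrite ∑-map (λ u → δ u []) (c ∷_) (insertions a v) | ∑-0 (insertions a v) = refl
  insertions-deletions a []      (b ∷ w)
    rewrite ∑-deletions-∷ (δ []) a b w | ∑-0 (deletions a w) = refl
  insertions-deletions a (c ∷ v) (b ∷ w)
    rewrite ∑-deletions-∷ (δ (c ∷ v)) a b w
          | ∑-map (λ u → δ u (b ∷ w)) (c ∷_) (insertions a v)
          | ∑-* (δ₁ c b) (λ u → δ u w) (insertions a v)
          | ∑-* (δ₁ c b) (δ v) (deletions a w)
          | insertions-deletions a v w = refl

  -- Both sides count the pairs (v, w) in which w arises from v by inserting a.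
  double-counting : ∀ a {R R′} → Unique R → Unique R′ →
    (∀ {v u} → v ∈ R → u ∈ insertions a v → u ∈ R′) →
    (∀ {w v} → w ∈ R′ → v ∈ deletions a w → v ∈ R) →
    (φ : List A → ℚ) →
    ∑ (λ v → ∑ φ (insertions a v)) R ≡ ∑ (λ w → ♯ (count a w) ℚ.* φ w) R′
  double-counting a {R} {R′} R! R′! ins del φ = begin
    ∑ (λ v → ∑ φ (insertions a v)) R
      -- By `ins`, u occurs in the duplicate-free list `R′`, so φ u is a sum over `R′` against `δ`;
      -- this introduces w as a summation variable.
      ≡⟨ ∑-cong R (λ v∈ → ∑-cong _ (λ u∈ → sym (∑-δ φ R′! (ins v∈ u∈)))) ⟩
    ∑ (λ v → ∑ (λ u → ∑ (λ w → δ u w ℚ.* φ w) R′) (insertions a v)) R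
      ≡⟨ ∑-cong R (λ {v} _ → ∑-swap (λ u w → δ u w ℚ.* φ w) (insertions a v) R′) ⟩
    ∑ (λ v → ∑ (λ w → ∑ (λ u → δ u w ℚ.* φ w) (insertions a v)) R′) R
      ≡⟨ ∑-cong R (λ {v} _ → ∑-cong R′ (λ {w} _ → transfer v w)) ⟩
    ∑ (λ v → ∑ (λ w → φ w ℚ.* ∑ (δ v) (deletions a w)) R′) R
      ≡⟨ ∑-swap (λ v w → φ w ℚ.* ∑ (δ v) (deletions a w)) R R′ ⟩
    ∑ (λ w → ∑ (λ v → φ w ℚ.* ∑ (δ v) (deletions a w)) R) R′
      ≡⟨ ∑-cong R′ collect ⟩
    ∑ (λ w → ♯ (count a w) ℚ.* φ w) R′ ∎
    where
    transfer : ∀ v w → ∑ (λ u → δ u w ℚ.* φ w) (insertions a v) ≡ φ w ℚ.* ∑ (δ v) (deletions a w)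
    transfer v w = begin
      ∑ (λ u → δ u w ℚ.* φ w) (insertions a v) ≡⟨ ∑-cong (insertions a v) (λ {u} _ → ℚ.*-comm (δ u w) (φ w)) ⟩
      ∑ (λ u → φ w ℚ.* δ u w) (insertions a v) ≡⟨ ∑-* (φ w) (λ u → δ u w) (insertions a v) ⟩
      φ w ℚ.* ∑ (λ u → δ u w) (insertions a v) ≡⟨ cong (φ w ℚ.*_) (insertions-deletions a v w) ⟩
      φ w ℚ.* ∑ (δ v) (deletions a w)          ∎

    collect : ∀ {w} → w ∈ R′ → ∑ (λ v → φ w ℚ.* ∑ (δ v) (deletions a w)) R ≡ ♯ (count a w) ℚ.* φ w
    collect {w} w∈ = begin
      ∑ (λ v → φ w ℚ.* ∑ (δ v) (deletions a w)) R
        ≡⟨ ∑-* (φ w) (λ v → ∑ (δ v) (deletions a w)) R ⟩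
      φ w ℚ.* ∑ (λ v → ∑ (δ v) (deletions a w)) R
        ≡⟨ cong (φ w ℚ.*_) (∑-swap δ R (deletions a w)) ⟩
      φ w ℚ.* ∑ (λ u → ∑ (λ v → δ v u) R) (deletions a w)
        -- By `del`, each deletion of w occurs in `R`, and exactly once, so its inner sum is 1.
        ≡⟨ cong (φ w ℚ.*_) (∑-cong (deletions a w) (λ {u} u∈ →
             trans (∑-cong R (λ {v} _ → trans (δ-sym v u) (sym (ℚ.*-identityʳ (δ u v)))))
                   (∑-δ (λ _ → 1ℚ) R! (del w∈ u∈)))) ⟩
      φ w ℚ.* ∑ (λ _ → 1ℚ) (deletions a w)
        ≡⟨ cong (φ w ℚ.*_) (∑-deletions-1 a w) ⟩
      φ w ℚ.* ♯ (count a w)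
        ≡⟨ ℚ.*-comm (φ w) _ ⟩
      ♯ (count a w) ℚ.* φ w ∎

-- Descents of the insertions of a letter

module Descents {A : Set} {_<_ : Rel A 0ℓ} (_≟_ : DecidableEquality A) (_<?_ : Decidable _<_)
                (isSTO : IsStrictTotalOrder _≡_ _<_) where

  open Occurrences _≟_
  open IsStrictTotalOrder isSTO using (compare) renaming (trans to <-trans)

  trichotomy : ∀ a b → ι (b ≟ a) ℕ.+ ι (a <? b) ℕ.+ ι (b <? a) ≡ 1
  trichotomy a b with compare a b
  ... | tri< a<b a≢b b≮a
    rewrite ι-no (b ≟ a) (λ b≡a → a≢b (sym b≡a)) | ι-yes (a <? b) a<b | ι-no (b <? a) b≮a = refl
  ... | tri≈ a≮b a≡b b≮a
    rewrite ι-yes (b ≟ a) (sym a≡b) | ι-no (a <? b) a≮b | ι-no (b <? a) b≮a = refl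
  ... | tri> a≮b a≢b b<a
    rewrite ι-no (b ≟ a) (λ b≡a → a≢b (sym b≡a)) | ι-no (a <? b) a≮b | ι-yes (b <? a) b<a = refl

  -- The pair c b is replaced by c a and a b. If b < c, at least one of these is a descent, since
  -- otherwise c ≤ a ≤ b; if not b < c, they cannot both be, since b < a < c.
  insert-between : ∀ a b c → let i = ι (a <? c) ℕ.+ ι (b <? a) in
    (i ≡ ι (b <? c)) ⊎ (i ≡ suc (ι (b <? c)))
  insert-between a b c with a <? c | b <? a | b <? c
  ... | yes a<c | yes b<a | yes b<c = inj₂ refl
  ... | yes a<c | yes b<a | no b≮c  = ⊥-elim (b≮c (<-trans b<a a<c))
  ... | yes a<c | no b≮a  | yes b<c = inj₁ refl
  ... | yes a<c | no b≮a  | no b≮c  = inj₂ refl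
  ... | no a≮c  | yes b<a | yes b<c = inj₁ refl
  ... | no a≮c  | yes b<a | no b≮c  = inj₂ refl
  ... | no a≮c  | no b≮a  | no b≮c  = inj₁ refl
  ... | no a≮c  | no b≮a  | yes b<c with compare a b
  ...   | tri< a<b _ _    = ⊥-elim (a≮c (<-trans a<b b<c))
  ...   | tri≈ _ refl _   = ⊥-elim (a≮c b<c)
  ...   | tri> _ _ b<a    = ⊥-elim (b≮a b<a)

  -- The algebra of the inductive step in `∑-insertions` when the front slot creates no descent.
  -- With k = n - l + d, the hypotheses give n′ - α + d′ = k + 1 and m′ = m + 1, so only the
  -- coefficient of p grows, by 1. In `slot-raised` the same quantity stays k and only the
  -- coefficient of q grows.
  slot-kept : ∀ {n l d p q m i β α e n′ d′ m′} →
    e ≡ (1ℚ ℚ.- l) ℚ.- β → α ≡ i ℚ.- β → n′ ≡ e ℚ.+ n → d′ ≡ i ℚ.+ d → m′ ≡ 1ℚ ℚ.+ m →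
    p ℚ.+ ((1ℚ ℚ.+ ((n ℚ.- l) ℚ.+ d)) ℚ.* p ℚ.+ (m ℚ.- ((n ℚ.- l) ℚ.+ d)) ℚ.* q) ≡
    (1ℚ ℚ.+ ((n′ ℚ.- α) ℚ.+ d′)) ℚ.* p ℚ.+ (m′ ℚ.- ((n′ ℚ.- α) ℚ.+ d′)) ℚ.* q
  slot-kept {n} {l} {d} {p} {q} {m} {i} {β} refl refl refl refl refl =
    solve 8 (λ n l d p q m i β →
      p :+ ((con 1ℚ :+ ((n :- l) :+ d)) :* p :+ (m :- ((n :- l) :+ d)) :* q) :=
      (con 1ℚ :+ (((((con 1ℚ :- l) :- β) :+ n) :- (i :- β)) :+ (i :+ d))) :* p :+
      ((con 1ℚ :+ m) :- (((((con 1ℚ :- l) :- β) :+ n) :- (i :- β)) :+ (i :+ d))) :* q)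
      refl n l d p q m i β

  slot-raised : ∀ {n l d p q m i β α e n′ d′ m′} →
    e ≡ (1ℚ ℚ.- l) ℚ.- β → α ≡ (1ℚ ℚ.+ i) ℚ.- β → n′ ≡ e ℚ.+ n → d′ ≡ i ℚ.+ d → m′ ≡ 1ℚ ℚ.+ m →
    q ℚ.+ ((1ℚ ℚ.+ ((n ℚ.- l) ℚ.+ d)) ℚ.* p ℚ.+ (m ℚ.- ((n ℚ.- l) ℚ.+ d)) ℚ.* q) ≡
    (1ℚ ℚ.+ ((n′ ℚ.- α) ℚ.+ d′)) ℚ.* p ℚ.+ (m′ ℚ.- ((n′ ℚ.- α) ℚ.+ d′)) ℚ.* q
  slot-raised {n} {l} {d} {p} {q} {m} {i} {β} refl refl refl refl refl =
    solve 8 (λ n l d p q m i β →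
      q :+ ((con 1ℚ :+ ((n :- l) :+ d)) :* p :+ (m :- ((n :- l) :+ d)) :* q) :=
      (con 1ℚ :+ (((((con 1ℚ :- l) :- β) :+ n) :- ((con 1ℚ :+ i) :- β)) :+ (i :+ d))) :* p :+
      ((con 1ℚ :+ m) :- (((((con 1ℚ :- l) :- β) :+ n) :- ((con 1ℚ :+ i) :- β)) :+ (i :+ d))) :* q)
      refl n l d p q m i β

  -- Of the |w| + 1 slots, 1 + k keep the number of descents and |w| - k raise it by one. The
  -- induction is over w with c and φ arbitrary.
  ∑-insertions : ∀ (φ : ℕ → ℚ) a c w →
    let d = descents _<?_ (c ∷ w)
        k = (♯ (count a w) ℚ.- ♯ (ι (a <? c))) ℚ.+ ♯ d
    in ∑ (λ u → φ (descents _<?_ (c ∷ u))) (insertions a w)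
       ≡ (1ℚ ℚ.+ k) ℚ.* φ d ℚ.+ (♯ (length w) ℚ.- k) ℚ.* φ (suc d)
  ∑-insertions φ a c [] with a <? c
  -- For the empty word and a < c the value of k is -1: the only slot creates a descent.
  ... | yes _ = solve 2 (λ p q → q :+ con 0ℚ := (con 1ℚ :+ ((con 0ℚ :- con 1ℚ) :+ con 0ℚ)) :* p :+ (con 0ℚ :- ((con 0ℚ :- con 1ℚ) :+ con 0ℚ)) :* q) refl (φ 0) (φ 1)
  ... | no _  = solve 2 (λ p q → p :+ con 0ℚ := (con 1ℚ :+ ((con 0ℚ :- con 0ℚ) :+ con 0ℚ)) :* p :+ (con 0ℚ :- ((con 0ℚ :- con 0ℚ) :+ con 0ℚ)) :* q) refl (φ 0) (φ 1)
  ∑-insertions φ a c (b ∷ w) = begin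
    φ (α ℕ.+ (β ℕ.+ d)) ℚ.+ ∑ (λ u → φ (descents _<?_ (c ∷ u))) (map (b ∷_) (insertions a w))
      ≡⟨ cong₂ ℚ._+_ (cong φ (sym (ℕ.+-assoc α β d))) (∑-map (λ u → φ (descents _<?_ (c ∷ u))) (b ∷_) (insertions a w)) ⟩
    φ (α ℕ.+ β ℕ.+ d) ℚ.+ ∑ (λ u → φ (i ℕ.+ descents _<?_ (b ∷ u))) (insertions a w)
      -- Insertions behind b leave the pair c b intact: b becomes the fixed front letter, and φ is
      -- shifted by the bracket i of that pair.
      ≡⟨ cong (φ (α ℕ.+ β ℕ.+ d) ℚ.+_) (∑-insertions (λ e → φ (i ℕ.+ e)) a b w) ⟩
    φ (α ℕ.+ β ℕ.+ d) ℚ.+ ((1ℚ ℚ.+ ((n ℚ.- l) ℚ.+ ♯ d)) ℚ.* φ (i ℕ.+ d) ℚ.+ (m ℚ.- ((n ℚ.- l) ℚ.+ ♯ d)) ℚ.* φ (i ℕ.+ suc d))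
      ≡⟨ cong (λ e → φ (α ℕ.+ β ℕ.+ d) ℚ.+ ((1ℚ ℚ.+ ((n ℚ.- l) ℚ.+ ♯ d)) ℚ.* φ (i ℕ.+ d) ℚ.+ (m ℚ.- ((n ℚ.- l) ℚ.+ ♯ d)) ℚ.* φ e)) (ℕ.+-suc i d) ⟩
    φ (α ℕ.+ β ℕ.+ d) ℚ.+ ((1ℚ ℚ.+ ((n ℚ.- l) ℚ.+ ♯ d)) ℚ.* φ (i ℕ.+ d) ℚ.+ (m ℚ.- ((n ℚ.- l) ℚ.+ ♯ d)) ℚ.* φ (suc (i ℕ.+ d)))
      ≡⟨ assemble (insert-between a b c) ⟩
    (1ℚ ℚ.+ ((♯ (e ℕ.+ count a w) ℚ.- ♯ α) ℚ.+ ♯ (i ℕ.+ d))) ℚ.* φ (i ℕ.+ d) ℚ.+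
      (♯ (suc (length w)) ℚ.- ((♯ (e ℕ.+ count a w) ℚ.- ♯ α) ℚ.+ ♯ (i ℕ.+ d))) ℚ.* φ (suc (i ℕ.+ d)) ∎
    where
    d = descents _<?_ (b ∷ w)
    α = ι (a <? c)
    β = ι (b <? a)
    i = ι (b <? c)
    e = ι (b ≟ a)
    n = ♯ (count a w)
    l = ♯ (ι (a <? b))
    m = ♯ (length w)
    tail = (1ℚ ℚ.+ ((n ℚ.- l) ℚ.+ ♯ d)) ℚ.* φ (i ℕ.+ d) ℚ.+ (m ℚ.- ((n ℚ.- l) ℚ.+ ♯ d)) ℚ.* φ (suc (i ℕ.+ d))

    e≡ : ♯ e ≡ (1ℚ ℚ.- l) ℚ.- ♯ β
    e≡ = begin
      ♯ e                                     ≡⟨ solve 3 (λ p q r → p := ((p :+ q :+ r) :- q) :- r) refl (♯ e) l (♯ β) ⟩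
      ((♯ e ℚ.+ l ℚ.+ ♯ β) ℚ.- l) ℚ.- ♯ β     ≡⟨ cong (λ s → (s ℚ.- l) ℚ.- ♯ β) sum≡1 ⟩
      (1ℚ ℚ.- l) ℚ.- ♯ β                      ∎
      where
      sum≡1 : ♯ e ℚ.+ l ℚ.+ ♯ β ≡ 1ℚ
      sum≡1 = begin
        ♯ e ℚ.+ l ℚ.+ ♯ β            ≡⟨ cong (ℚ._+ ♯ β) (♯-+ e (ι (a <? b))) ⟨
        ♯ (e ℕ.+ ι (a <? b)) ℚ.+ ♯ β ≡⟨ ♯-+ (e ℕ.+ ι (a <? b)) β ⟨
        ♯ (e ℕ.+ ι (a <? b) ℕ.+ β)   ≡⟨ cong ♯ (trichotomy a b) ⟩
        1ℚ                           ∎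

    α≡ : ∀ j → α ℕ.+ β ≡ j → ♯ α ≡ ♯ j ℚ.- ♯ β
    α≡ j α+β≡j = begin
      ♯ α                      ≡⟨ solve 2 (λ p q → p := (p :+ q) :- q) refl (♯ α) (♯ β) ⟩
      (♯ α ℚ.+ ♯ β) ℚ.- ♯ β    ≡⟨ cong (ℚ._- ♯ β) (♯-+ α β) ⟨
      ♯ (α ℕ.+ β) ℚ.- ♯ β      ≡⟨ cong (λ j → ♯ j ℚ.- ♯ β) α+β≡j ⟩
      ♯ j ℚ.- ♯ β              ∎

    assemble : (α ℕ.+ β ≡ i) ⊎ (α ℕ.+ β ≡ suc i) →
      φ (α ℕ.+ β ℕ.+ d) ℚ.+ ((1ℚ ℚ.+ ((n ℚ.- l) ℚ.+ ♯ d)) ℚ.* φ (i ℕ.+ d) ℚ.+ (m ℚ.- ((n ℚ.- l) ℚ.+ ♯ d)) ℚ.* φ (suc (i ℕ.+ d)))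
      ≡ (1ℚ ℚ.+ ((♯ (e ℕ.+ count a w) ℚ.- ♯ α) ℚ.+ ♯ (i ℕ.+ d))) ℚ.* φ (i ℕ.+ d) ℚ.+
        (♯ (suc (length w)) ℚ.- ((♯ (e ℕ.+ count a w) ℚ.- ♯ α) ℚ.+ ♯ (i ℕ.+ d))) ℚ.* φ (suc (i ℕ.+ d))
    assemble (inj₁ α+β≡i) = trans (cong (λ j → φ (j ℕ.+ d) ℚ.+ tail) α+β≡i)
      (slot-kept {n} {l} {♯ d} {m = m} {♯ i} {♯ β} e≡ (α≡ i α+β≡i) (♯-+ e (count a w)) (♯-+ i d) refl)
    assemble (inj₂ α+β≡1+i) = trans (cong (λ j → φ (j ℕ.+ d) ℚ.+ tail) α+β≡1+i)
      (slot-raised {n} {l} {♯ d} {m = m} {♯ i} {♯ β} e≡ (α≡ (suc i) α+β≡1+i) (♯-+ e (count a w)) (♯-+ i d) refl)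

  -- Double counting turns the sum over insertions into a weighted sum over `R′`. Here κ is the part
  -- of k that does not involve descents; the remaining summand d accounts for the slope e = 1.
  insertion-recurrence : ∀ a c {R R′} → Unique R → Unique R′ →
    (∀ {v u} → v ∈ R → u ∈ insertions a v → u ∈ R′) →
    (∀ {w v} → w ∈ R′ → v ∈ deletions a w → v ∈ R) →
    (φ : ℕ → ℚ) →
    let κ = λ v → ♯ (count a v) ℚ.- ♯ (ι (a <? c)) in
    ∑ (λ w → ♯ (count a w) ℚ.* φ (descents _<?_ (c ∷ w))) R′ ≡
    ∑ (λ v → adjoint (1ℚ ℚ.+ κ v) (♯ (length v) ℚ.- κ v) 1ℚ φ (descents _<?_ (c ∷ v))) R
  insertion-recurrence a c {R} {R′} R! R′! ins del φ = begin
    ∑ (λ w → ♯ (count a w) ℚ.* φ (des′ w)) R′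
      ≡⟨ double-counting a R! R′! ins del (λ w → φ (des′ w)) ⟨
    ∑ (λ v → ∑ (λ u → φ (des′ u)) (insertions a v)) R
      ≡⟨ ∑-cong R (λ {v} _ → trans (∑-insertions φ a c v)
           (regroup (κ v) (♯ (length v)) (♯ (des′ v)) (φ (des′ v)) (φ (suc (des′ v))))) ⟩
    ∑ (λ v → adjoint (1ℚ ℚ.+ κ v) (♯ (length v) ℚ.- κ v) 1ℚ φ (des′ v)) R ∎
    where
    des′ : List A → ℕ
    des′ v = descents _<?_ (c ∷ v)
    κ : List A → ℚ
    κ v = ♯ (count a v) ℚ.- ♯ (ι (a <? c))
    regroup : ∀ κ m d p q → (1ℚ ℚ.+ (κ ℚ.+ d)) ℚ.* p ℚ.+ (m ℚ.- (κ ℚ.+ d)) ℚ.* q ≡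
      ((1ℚ ℚ.+ κ) ℚ.+ 1ℚ ℚ.* d) ℚ.* p ℚ.+ ((m ℚ.- κ) ℚ.- 1ℚ ℚ.* d) ℚ.* q
    regroup = solve 5 (λ κ m d p q → (con 1ℚ :+ (κ :+ d)) :* p :+ (m :- (κ :+ d)) :* q :=
      ((con 1ℚ :+ κ) :+ con 1ℚ :* d) :* p :+ ((m :- κ) :- con 1ℚ :* d) :* q) refl

-- Unsigned words

module ℕ-words = Occurrences ℕ._≟_
module ℤ-words = Occurrences ℤ._≟_
open ℕ-words using () renaming (count to countℕ)
open ℤ-words using () renaming (count to countℤ)

-- No natural number lies below 0, so unsigned words fit the recurrence with front letter c = 0.
des-0∷ : ∀ w → descents ℕ._<?_ (0 ∷ w) ≡ des w
des-0∷ []      = refl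
des-0∷ (_ ∷ _) = refl

-- Every rearrangement of `a ∷ M` contains a exactly c + 1 times, so the weight is constant and
-- leaves the sum.
∑-rearrangements-∷ : ∀ a M {c m} → countℕ a M ≡ c → length M ≡ m → (φ : ℕ → ℚ) →
  ♯ (suc c) ℚ.* ∑ (λ w → φ (des w)) (rearrangements (a ∷ M)) ≡
  ∑ (λ v → adjoint (1ℚ ℚ.+ ♯ c) (♯ m ℚ.- ♯ c) 1ℚ φ (des v)) (rearrangements M)
∑-rearrangements-∷ a M {c} {m} refl refl φ = begin
  ♯ (suc c) ℚ.* ∑ (λ w → φ (des w)) R′
    ≡⟨ ∑-* (♯ (suc c)) (λ w → φ (des w)) R′ ⟨
  ∑ (λ w → ♯ (suc c) ℚ.* φ (des w)) R′
    ≡⟨ ∑-cong R′ (λ {w} w∈ → cong₂ ℚ._*_ (cong ♯ (sym (count≡ w∈))) (cong φ (sym (des-0∷ w)))) ⟩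
  ∑ (λ w → ♯ (countℕ a w) ℚ.* φ (des₀ w)) R′
    ≡⟨ Descents.insertion-recurrence ℕ._≟_ ℕ._<?_ ℕ.<-isStrictTotalOrder a 0
         (rearrangements-unique M) (rearrangements-unique (a ∷ M))
         (λ {v} v∈ u∈ → from (∈-rearrangements (a ∷ M) _)
           (↭-trans (insertions-↭ v u∈) (↭-prep a (to (∈-rearrangements M v) v∈))))
         (λ {w} w∈ v∈ → from (∈-rearrangements M _)
           (drop-∷ (↭-trans (ℕ-words.deletions-↭ w v∈) (to (∈-rearrangements (a ∷ M) w) w∈))))
         φ ⟩
  ∑ (λ v → adjoint (1ℚ ℚ.+ (♯ (countℕ a v) ℚ.- 0ℚ)) (♯ (length v) ℚ.- (♯ (countℕ a v) ℚ.- 0ℚ)) 1ℚ φ (des₀ v)) R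
    ≡⟨ ∑-cong R (λ {v} v∈ → simplify (des-0∷ v)
         (ℕ-words.count-↭ a (to (∈-rearrangements M v) v∈)) (↭-length (to (∈-rearrangements M v) v∈))) ⟩
  ∑ (λ v → adjoint (1ℚ ℚ.+ ♯ c) (♯ m ℚ.- ♯ c) 1ℚ φ (des v)) R ∎
  where
  R = rearrangements M
  R′ = rearrangements (a ∷ M)
  des₀ : List ℕ → ℕ
  des₀ w = descents ℕ._<?_ (0 ∷ w)

  count≡ : ∀ {w} → w ∈ R′ → countℕ a w ≡ suc c
  count≡ {w} w∈ = trans (ℕ-words.count-↭ a (to (∈-rearrangements (a ∷ M) w) w∈))
    (cong (ℕ._+ c) (ι-yes (a ℕ.≟ a) refl))

  simplify : ∀ {d d′ c c′ m m′} → d ≡ d′ → c ≡ c′ → m ≡ m′ →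
    adjoint (1ℚ ℚ.+ (♯ c ℚ.- 0ℚ)) (♯ m ℚ.- (♯ c ℚ.- 0ℚ)) 1ℚ φ d ≡
    adjoint (1ℚ ℚ.+ ♯ c′) (♯ m′ ℚ.- ♯ c′) 1ℚ φ d′
  simplify {d} {c = c} {m = m} refl refl refl =
    cong (λ c → adjoint (1ℚ ℚ.+ c) (♯ m ℚ.- c) 1ℚ φ d) (ℚ.+-identityʳ (♯ c))

-- Signed words

rearrangements± : List ℕ → List (List ℤ)
rearrangements± M = concatMap signings (rearrangements M)

∈-signings : ∀ w {v} → (v ∈ signings w) ⇔ (map ∣_∣ v ≡ w)
∈-signings w = mk⇔ (abs w) (λ { refl → sign _ })
  where
  abs : ∀ w {v} → v ∈ signings w → map ∣_∣ v ≡ w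
  abs []      (here refl) = refl
  abs (a ∷ w) v∈ with ∈-cartesianProductWith⁻ _∷_ (+ a ∷ ℤ.- (+ a) ∷ []) (signings w) v∈
  ... | _ , v′ , here refl         , v′∈ , refl = cong (a ∷_) (abs w v′∈)
  ... | _ , v′ , there (here refl) , v′∈ , refl = cong₂ _∷_ (ℤ.∣-i∣≡∣i∣ (+ a)) (abs w v′∈)

  sign : ∀ v → v ∈ signings (map ∣_∣ v)
  sign []      = here refl
  sign (b ∷ v) = ∈-cartesianProductWith⁺ _∷_ (sign₁ b) (sign v)
    where
    sign₁ : ∀ b → b ∈ + ∣ b ∣ ∷ ℤ.- (+ ∣ b ∣) ∷ []
    sign₁ (+ _)    = here refl
    sign₁ -[1+ _ ] = there (here refl)

-- A letter 0 would coincide with its own negative and produce repeated words.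
signings-unique : ∀ {w} → All (_≢ 0) w → Unique (signings w)
signings-unique []          = [] ∷ []
signings-unique (a≢0 ∷ w≢0) =
  Unique.cartesianProductWith⁺ _∷_ ∷-injective ((+≢- a≢0 ∷ []) ∷ [] ∷ []) (signings-unique w≢0)
  where
  +≢- : ∀ {a} → a ≢ 0 → + a ≢ ℤ.- (+ a)
  +≢- {zero}  a≢0 _ = a≢0 refl
  +≢- {suc _} _ ()

signings-disjoint : ∀ {v w} → v ≢ w → Disjoint (signings v) (signings w)
signings-disjoint {v} {w} v≢w (u∈v , u∈w) = v≢w (trans (sym (to (∈-signings v) u∈v)) (to (∈-signings w) u∈w))

∈-rearrangements± : ∀ M w → (w ∈ rearrangements± M) ⇔ (map ∣_∣ w ↭ M)
∈-rearrangements± M w = mk⇔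
  (λ w∈ → let (v , v∈ , w∈v) = find (∈-concatMap⁻ signings {xs = rearrangements M} w∈) in
    subst (_↭ M) (sym (to (∈-signings v) w∈v)) (to (∈-rearrangements M v) v∈))
  (λ p → ∈-concatMap⁺ signings (Any.map (λ { refl → from (∈-signings _) refl })
    (from (∈-rearrangements M (map ∣_∣ w)) p)))

rearrangements±-unique : ∀ {M} → All (_≢ 0) M → Unique (rearrangements± M)
rearrangements±-unique {M} M≢0 = Unique.concat⁺
  (All.map⁺ (All.tabulate λ {w} w∈ → signings-unique
    (All.tabulate λ a∈w → All.lookup M≢0 (∈-resp-↭ (to (∈-rearrangements M w) w∈) a∈w))))
  (AllPairs.map⁺ (AllPairs.map signings-disjoint (rearrangements-unique M)))

count-∣∣ : ∀ n w → countℤ (+ suc n) w ℕ.+ countℤ -[1+ n ] w ≡ countℕ (suc n) (map ∣_∣ w)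
count-∣∣ n []      = refl
count-∣∣ n (b ∷ w) = begin
  (p ℕ.+ countℤ (+ suc n) w) ℕ.+ (q ℕ.+ countℤ -[1+ n ] w) ≡⟨ interchange ℕ.+-commutativeSemigroup p (countℤ (+ suc n) w) q (countℤ -[1+ n ] w) ⟩
  (p ℕ.+ q) ℕ.+ (countℤ (+ suc n) w ℕ.+ countℤ -[1+ n ] w) ≡⟨ cong₂ ℕ._+_ (letter b) (count-∣∣ n w) ⟩
  ι (∣ b ∣ ℕ.≟ suc n) ℕ.+ countℕ (suc n) (map ∣_∣ w)       ∎
  where
  p = ι (b ℤ.≟ + suc n)
  q = ι (b ℤ.≟ -[1+ n ])
  letter : ∀ b → ι (b ℤ.≟ + suc n) ℕ.+ ι (b ℤ.≟ -[1+ n ]) ≡ ι (∣ b ∣ ℕ.≟ suc n)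
  letter b with ∣ b ∣ ℕ.≟ suc n
  letter (+ _)    | yes refl rewrite ι-yes (+ suc n ℤ.≟ + suc n) refl = refl
  letter -[1+ _ ] | yes refl rewrite ι-yes (-[1+ n ] ℤ.≟ -[1+ n ]) refl = refl
  letter b        | no ∣b∣≢
    rewrite ι-no (b ℤ.≟ + suc n) (λ { refl → ∣b∣≢ refl })
          | ι-no (b ℤ.≟ -[1+ n ]) (λ { refl → ∣b∣≢ refl }) = refl

-- The multiset fixes only the total number of letters a and -a, so the count of a alone depends on
-- the word and the weights stay under the sums.
∑-rearrangements±-∷ : ∀ a M {m} → length M ≡ m → All (_≢ 0) (∣ a ∣ ∷ M) → (φ : ℕ → ℚ) →
  let κ = λ v → ♯ (countℤ a v) ℚ.- ♯ (ι (a ℤ.<? 0ℤ)) in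
  ∑ (λ w → ♯ (countℤ a w) ℚ.* φ (desB w)) (rearrangements± (∣ a ∣ ∷ M)) ≡
  ∑ (λ v → adjoint (1ℚ ℚ.+ κ v) (♯ m ℚ.- κ v) 1ℚ φ (desB v)) (rearrangements± M)
∑-rearrangements±-∷ a M refl ≢0@(_ ∷ M≢0) φ = trans
  (Descents.insertion-recurrence ℤ._≟_ ℤ._<?_ ℤ.<-isStrictTotalOrder a 0ℤ
    (rearrangements±-unique M≢0) (rearrangements±-unique ≢0)
    (λ {v} v∈ u∈ → from (∈-rearrangements± (∣ a ∣ ∷ M) _)
      (↭-trans (↭-map⁺ ∣_∣ (insertions-↭ v u∈)) (↭-prep ∣ a ∣ (to (∈-rearrangements± M v) v∈))))
    (λ {w} w∈ v∈ → from (∈-rearrangements± M _)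
      (drop-∷ (↭-trans (↭-map⁺ ∣_∣ (ℤ-words.deletions-↭ w v∈)) (to (∈-rearrangements± (∣ a ∣ ∷ M) w) w∈))))
    φ)
  (∑-cong (rearrangements± M) (λ {v} v∈ → cong
    (λ m → let κ = ♯ (countℤ a v) ℚ.- ♯ (ι (a ℤ.<? 0ℤ)) in adjoint (1ℚ ℚ.+ κ) (♯ m ℚ.- κ) 1ℚ φ (desB v))
    (trans (sym (length-map ∣_∣ v)) (↭-length (to (∈-rearrangements± M v) v∈)))))

-- Adding the recurrences for N = n + 1 and -N makes the weights constant. Only -N lies below the
-- front letter 0, so the two values of κ add up to c - 1; this gives 2 + (c - 1), 2m - (c - 1) and
-- slope 2.
∑-rearrangements±-∷± : ∀ n M {c m} → countℕ (suc n) M ≡ c → length M ≡ m → All (_≢ 0) M → (φ : ℕ → ℚ) →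
  ♯ (suc c) ℚ.* ∑ (λ w → φ (desB w)) (rearrangements± (suc n ∷ M)) ≡
  ∑ (λ v → adjoint (1ℚ ℚ.+ ♯ c) ((♯ (suc m) ℚ.+ ♯ m) ℚ.- ♯ c) (♯ 2) φ (desB v)) (rearrangements± M)
∑-rearrangements±-∷± n M {c} {m} refl refl M≢0 φ = begin
  ♯ (suc c) ℚ.* ∑ (λ w → φ (desB w)) R′
    ≡⟨ ∑-* (♯ (suc c)) (λ w → φ (desB w)) R′ ⟨
  ∑ (λ w → ♯ (suc c) ℚ.* φ (desB w)) R′
    ≡⟨ ∑-cong R′ (λ {w} w∈ → trans (cong (ℚ._* φ (desB w)) (count-split w∈)) (ℚ.*-distribʳ-+ (φ (desB w)) (c₊ w) (c₋ w))) ⟩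
  ∑ (λ w → c₊ w ℚ.* φ (desB w) ℚ.+ c₋ w ℚ.* φ (desB w)) R′
    ≡⟨ ∑-+ (λ w → c₊ w ℚ.* φ (desB w)) (λ w → c₋ w ℚ.* φ (desB w)) R′ ⟩
  ∑ (λ w → c₊ w ℚ.* φ (desB w)) R′ ℚ.+ ∑ (λ w → c₋ w ℚ.* φ (desB w)) R′
    ≡⟨ cong₂ ℚ._+_ (∑-rearrangements±-∷ (+ suc n) M refl ((λ ()) ∷ M≢0) φ)
                   (∑-rearrangements±-∷ -[1+ n ] M refl ((λ ()) ∷ M≢0) φ) ⟩
  ∑ f₊ R ℚ.+ ∑ f₋ R
    ≡⟨ ∑-+ f₊ f₋ R ⟨
  ∑ (λ v → f₊ v ℚ.+ f₋ v) R
    ≡⟨ ∑-cong R (λ {v} v∈ → trans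
         (adjoint-+ (1ℚ ℚ.+ (c₊ v ℚ.- 0ℚ)) (♯ m ℚ.- (c₊ v ℚ.- 0ℚ)) 1ℚ (1ℚ ℚ.+ (c₋ v ℚ.- 1ℚ)) (♯ m ℚ.- (c₋ v ℚ.- 1ℚ)) 1ℚ φ (desB v))
         (collect (c₊ v) (c₋ v) (♯ m) (desB v) (count-total (to (∈-rearrangements± M v) v∈)))) ⟩
  ∑ (λ v → adjoint (1ℚ ℚ.+ ♯ c) ((♯ (suc m) ℚ.+ ♯ m) ℚ.- ♯ c) (♯ 2) φ (desB v)) R ∎
  where
  R = rearrangements± M
  R′ = rearrangements± (suc n ∷ M)
  c₊ c₋ f₊ f₋ : List ℤ → ℚ
  c₊ w = ♯ (countℤ (+ suc n) w)
  c₋ w = ♯ (countℤ -[1+ n ] w)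
  f₊ v = adjoint (1ℚ ℚ.+ (c₊ v ℚ.- 0ℚ)) (♯ m ℚ.- (c₊ v ℚ.- 0ℚ)) 1ℚ φ (desB v)
  f₋ v = adjoint (1ℚ ℚ.+ (c₋ v ℚ.- 1ℚ)) (♯ m ℚ.- (c₋ v ℚ.- 1ℚ)) 1ℚ φ (desB v)

  count-total : ∀ {M v} → map ∣_∣ v ↭ M → ♯ (countℕ (suc n) M) ≡ c₊ v ℚ.+ c₋ v
  count-total {M} {v} p = trans (cong ♯ (trans (sym (ℕ-words.count-↭ (suc n) p)) (sym (count-∣∣ n v))))
    (♯-+ (countℤ (+ suc n) v) (countℤ -[1+ n ] v))

  count-split : ∀ {w} → w ∈ R′ → ♯ (suc c) ≡ c₊ w ℚ.+ c₋ w
  count-split {w} w∈ = trans (cong (λ i → ♯ (i ℕ.+ c)) (sym (ι-yes (suc n ℕ.≟ suc n) refl)))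
    (count-total (to (∈-rearrangements± (suc n ∷ M) w) w∈))

  collect : ∀ y z m d {c} → c ≡ y ℚ.+ z →
    adjoint ((1ℚ ℚ.+ (y ℚ.- 0ℚ)) ℚ.+ (1ℚ ℚ.+ (z ℚ.- 1ℚ))) ((m ℚ.- (y ℚ.- 0ℚ)) ℚ.+ (m ℚ.- (z ℚ.- 1ℚ))) (1ℚ ℚ.+ 1ℚ) φ d ≡
    adjoint (1ℚ ℚ.+ c) (((1ℚ ℚ.+ m) ℚ.+ m) ℚ.- c) (♯ 2) φ d
  collect y z m d refl = adjoint-cong (♯ 2) φ d
    (solve 2 (λ y z → (con 1ℚ :+ (y :- con 0ℚ)) :+ (con 1ℚ :+ (z :- con 1ℚ)) := con 1ℚ :+ (y :+ z)) refl y z)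
    (solve 3 (λ y z m → (m :- (y :- con 0ℚ)) :+ (m :- (z :- con 1ℚ)) := ((con 1ℚ :+ m) :+ m) :- (y :+ z)) refl y z m)

-- The multisets {1,1,…,n,n} and {1,1,…,n,n,n+1}

♯-double : ∀ n → ♯ (2 ℕ.* n) ≡ ♯ n ℚ.+ ♯ n
♯-double n = trans (♯-+ n (n ℕ.+ 0)) (cong (λ m → ♯ n ℚ.+ ♯ m) (ℕ.+-identityʳ n))

doubled-≢0 : ∀ n → All (_≢ 0) (doubled n)
doubled-≢0 zero    = []
doubled-≢0 (suc n) = (λ ()) ∷ (λ ()) ∷ doubled-≢0 n

length-doubled : ∀ n → length (doubled n) ≡ 2 ℕ.* n
length-doubled zero    = refl
length-doubled (suc n) = trans (cong (λ m → 2 ℕ.+ m) (length-doubled n)) (sym (ℕ.*-suc 2 n))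

count-doubled : ∀ {m} n → n ℕ.< m → countℕ m (doubled n) ≡ 0
count-doubled     zero    n<m = refl
count-doubled {m} (suc n) n<m
  rewrite ι-no (suc n ℕ.≟ m) (ℕ.<⇒≢ n<m) = count-doubled n (ℕ.<-trans (ℕ.n<1+n n) n<m)

count-suc∷doubled : ∀ n → countℕ (suc n) (suc n ∷ doubled n) ≡ 1
count-suc∷doubled n = cong₂ ℕ._+_ (ι-yes (suc n ℕ.≟ suc n) refl) (count-doubled n (ℕ.n<1+n n))

∑-𝔇 : ∀ n φ → ∑ (λ w → φ (des w)) (𝔇 n) ≡ ∑ (λ v → adjoint 1ℚ (♯ (2 ℕ.* n)) 1ℚ φ (des v)) (𝒞 n)
∑-𝔇 n φ = begin
  ∑ (λ w → φ (des w)) (𝔇 n)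
    ≡⟨ ℚ.*-identityˡ (∑ (λ w → φ (des w)) (𝔇 n)) ⟨
  1ℚ ℚ.* ∑ (λ w → φ (des w)) (𝔇 n)
    ≡⟨ ∑-rearrangements-∷ (suc n) (doubled n) (count-doubled n (ℕ.n<1+n n)) (length-doubled n) φ ⟩
  ∑ (λ v → adjoint 1ℚ (♯ (2 ℕ.* n) ℚ.- 0ℚ) 1ℚ φ (des v)) (𝒞 n)
    ≡⟨ cong (λ b → ∑ (λ v → adjoint 1ℚ b 1ℚ φ (des v)) (𝒞 n)) (ℚ.+-identityʳ (♯ (2 ℕ.* n))) ⟩
  ∑ (λ v → adjoint 1ℚ (♯ (2 ℕ.* n)) 1ℚ φ (des v)) (𝒞 n) ∎

-- Removes the factor c + 1 = 2 that appears when a second letter of absolute value n + 1 is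
-- inserted.
halve : ∀ {p} a b e φ (stat : A → ℕ) L → ♯ 2 ℚ.* p ≡ ∑ (λ σ → adjoint a b e φ (stat σ)) L →
  p ≡ ∑ (λ σ → adjoint (½ ℚ.* a) (½ ℚ.* b) (½ ℚ.* e) φ (stat σ)) L
halve {p = p} a b e φ stat L 2p≡ = begin
  p                                            ≡⟨ solve 1 (λ p → p := con ½ :* (con (♯ 2) :* p)) refl p ⟩
  ½ ℚ.* (♯ 2 ℚ.* p)                            ≡⟨ cong (½ ℚ.*_) 2p≡ ⟩
  ½ ℚ.* ∑ (λ σ → adjoint a b e φ (stat σ)) L   ≡⟨ ∑-* ½ (λ σ → adjoint a b e φ (stat σ)) L ⟨
  ∑ (λ σ → ½ ℚ.* adjoint a b e φ (stat σ)) L   ≡⟨ ∑-cong L (λ {σ} _ → adjoint-* ½ a b e φ (stat σ)) ⟩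
  ∑ (λ σ → adjoint (½ ℚ.* a) (½ ℚ.* b) (½ ℚ.* e) φ (stat σ)) L ∎

∑-𝒞-suc : ∀ n φ → ∑ (λ w → φ (des w)) (𝒞 (suc n)) ≡ ∑ (λ v → adjoint 1ℚ (♯ n) ½ φ (des v)) (𝔇 n)
∑-𝒞-suc n φ = begin
  ∑ (λ w → φ (des w)) (𝒞 (suc n))
    ≡⟨ halve (♯ 2) b 1ℚ φ des (𝔇 n)
         (∑-rearrangements-∷ (suc n) (suc n ∷ doubled n) (count-suc∷doubled n) (cong suc (length-doubled n)) φ) ⟩
  ∑ (λ v → adjoint 1ℚ (½ ℚ.* b) ½ φ (des v)) (𝔇 n)
    ≡⟨ cong (λ b → ∑ (λ v → adjoint 1ℚ b ½ φ (des v)) (𝔇 n)) ½b≡n ⟩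
  ∑ (λ v → adjoint 1ℚ (♯ n) ½ φ (des v)) (𝔇 n) ∎
  where
  -- Words of `𝔇 n` have 2n + 1 letters, one of them n + 1; half of (2n + 1) - 1 is n.
  b = ♯ (suc (2 ℕ.* n)) ℚ.- ♯ 1
  ½b≡n : ½ ℚ.* b ≡ ♯ n
  ½b≡n = trans (cong (λ m → ½ ℚ.* ((1ℚ ℚ.+ m) ℚ.- ♯ 1)) (♯-double n))
    (solve 1 (λ n → con ½ :* ((con 1ℚ :+ (n :+ n)) :- con 1ℚ) := n) refl (♯ n))

-- The letter N = n + 1 occurs at most once, so requiring it to be positive amounts to weighting by
-- its count. It is absent from `𝒞± n` and not below 0, whence κ = 0.
∑-𝔇± : ∀ n φ → ∑ (λ w → φ (desB w)) (𝔇± n) ≡ ∑ (λ v → adjoint 1ℚ (♯ (2 ℕ.* n)) 1ℚ φ (desB v)) (𝒞± n)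
∑-𝔇± n φ = begin
  ∑ (λ w → φ (desB w)) (𝔇± n)
    ≡⟨ ∑-filter (λ w → (+ suc n) ∈ℤ? w) (λ w → φ (desB w)) R′ ⟩
  ∑ (λ w → ♯ (ι ((+ suc n) ∈ℤ? w)) ℚ.* φ (desB w)) R′
    ≡⟨ ∑-cong R′ (λ {w} w∈ → cong (λ c → ♯ c ℚ.* φ (desB w)) (sym (ℤ-words.count≤1⇒count≡ι w (count≤1 w∈)))) ⟩
  ∑ (λ w → ♯ (countℤ (+ suc n) w) ℚ.* φ (desB w)) R′
    ≡⟨ ∑-rearrangements±-∷ (+ suc n) (doubled n) (length-doubled n) ((λ ()) ∷ doubled-≢0 n) φ ⟩
  ∑ (λ v → adjoint (1ℚ ℚ.+ (♯ (countℤ (+ suc n) v) ℚ.- 0ℚ)) (♯ (2 ℕ.* n) ℚ.- (♯ (countℤ (+ suc n) v) ℚ.- 0ℚ)) 1ℚ φ (desB v)) (𝒞± n)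
    ≡⟨ ∑-cong (𝒞± n) (λ {v} v∈ → simplify (desB v) (count≡0 v∈)) ⟩
  ∑ (λ v → adjoint 1ℚ (♯ (2 ℕ.* n)) 1ℚ φ (desB v)) (𝒞± n) ∎
  where
  open DecMembership ℤ._≟_ using () renaming (_∈?_ to _∈ℤ?_)
  R′ = rearrangements± (suc n ∷ doubled n)

  count≤ : ∀ {M w} → w ∈ rearrangements± M → countℤ (+ suc n) w ℕ.≤ countℕ (suc n) M
  count≤ {M} {w} w∈ = ℕ.≤-trans (ℕ.m≤m+n _ (countℤ -[1+ n ] w))
    (ℕ.≤-reflexive (trans (count-∣∣ n w) (ℕ-words.count-↭ (suc n) (to (∈-rearrangements± M w) w∈))))

  count≤1 : ∀ {w} → w ∈ R′ → countℤ (+ suc n) w ℕ.≤ 1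
  count≤1 w∈ = ℕ.≤-trans (count≤ {suc n ∷ doubled n} w∈) (ℕ.≤-reflexive (count-suc∷doubled n))

  count≡0 : ∀ {v} → v ∈ 𝒞± n → countℤ (+ suc n) v ≡ 0
  count≡0 v∈ = ℕ.n≤0⇒n≡0 (ℕ.≤-trans (count≤ {doubled n} v∈) (ℕ.≤-reflexive (count-doubled n (ℕ.n<1+n n))))

  simplify : ∀ d {c} → c ≡ 0 →
    adjoint (1ℚ ℚ.+ (♯ c ℚ.- 0ℚ)) (♯ (2 ℕ.* n) ℚ.- (♯ c ℚ.- 0ℚ)) 1ℚ φ d ≡ adjoint 1ℚ (♯ (2 ℕ.* n)) 1ℚ φ d
  simplify d refl = cong (λ b → adjoint 1ℚ b 1ℚ φ d) (ℚ.+-identityʳ (♯ (2 ℕ.* n)))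

-- A word with two letters -N does not arise by insertion from `𝔇± n`, so both sides are carried
-- down to `𝒞± n`: the left through `E`, where N has either sign, the right by `∑-𝔇±`.
∑-𝒞±-suc : ∀ n φ → ∑ (λ w → φ (desB w)) (𝒞± (suc n)) ≡ ∑ (λ v → adjoint 1ℚ (♯ (3 ℕ.+ 4 ℕ.* n)) (♯ 2) φ (desB v)) (𝔇± n)
∑-𝒞±-suc n φ = begin
  ∑ (λ w → φ (desB w)) (𝒞± (suc n))
    ≡⟨ halve (♯ 2) b (♯ 2) φ desB E (∑-rearrangements±-∷± n (suc n ∷ doubled n)
         (count-suc∷doubled n) (cong suc (length-doubled n)) ((λ ()) ∷ doubled-≢0 n) φ) ⟩
  ∑ (λ u → χ (desB u)) E
    ≡⟨ ℚ.*-identityˡ (∑ (λ u → χ (desB u)) E) ⟨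
  1ℚ ℚ.* ∑ (λ u → χ (desB u)) E
    ≡⟨ ∑-rearrangements±-∷± n (doubled n) (count-doubled n (ℕ.n<1+n n)) (length-doubled n) (doubled-≢0 n) χ ⟩
  ∑ (λ v → adjoint 1ℚ ((♯ (suc m) ℚ.+ ♯ m) ℚ.- 0ℚ) (♯ 2) χ (desB v)) (𝒞± n)
    ≡⟨ ∑-cong (𝒞± n) (λ {v} _ →
         compare (♯ (desB v)) (♯ m) (φ (desB v)) (φ (suc (desB v))) (φ (suc (suc (desB v)))) ♯[3+4n]) ⟩
  ∑ (λ v → adjoint 1ℚ (♯ m) 1ℚ ψ (desB v)) (𝒞± n)
    ≡⟨ ∑-𝔇± n ψ ⟨
  ∑ (λ v → ψ (desB v)) (𝔇± n) ∎
  where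
  m = 2 ℕ.* n
  b = (♯ (suc (suc m)) ℚ.+ ♯ (suc m)) ℚ.- ♯ 1
  E = rearrangements± (suc n ∷ doubled n)
  χ ψ : ℕ → ℚ
  χ = adjoint 1ℚ (½ ℚ.* b) 1ℚ φ
  ψ = adjoint 1ℚ (♯ (3 ℕ.+ 4 ℕ.* n)) (♯ 2) φ

  ♯[3+4n] : ♯ (3 ℕ.+ 4 ℕ.* n) ≡ ♯ 3 ℚ.+ (♯ m ℚ.+ ♯ m)
  ♯[3+4n] = trans (♯-+ 3 (4 ℕ.* n)) (cong (♯ 3 ℚ.+_) (trans (cong ♯ (ℕ.*-assoc 2 2 n)) (♯-double m)))

  -- With m = 2n, (1, m + 1, 1) and (1, 2m + 1, 2) are the parameters of the two steps through `E`,
  -- and (1, 2m + 3, 2) and (1, m, 1) those of the route through `𝔇± n`. The composites agree in the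
  -- coefficients of φ d, φ (d + 1) and φ (d + 2).
  compare : ∀ d m p q r {t} → t ≡ ♯ 3 ℚ.+ (m ℚ.+ m) →
    let b = ½ ℚ.* (((1ℚ ℚ.+ (1ℚ ℚ.+ m)) ℚ.+ (1ℚ ℚ.+ m)) ℚ.- 1ℚ) in
    (1ℚ ℚ.+ ♯ 2 ℚ.* d) ℚ.* ((1ℚ ℚ.+ 1ℚ ℚ.* d) ℚ.* p ℚ.+ (b ℚ.- 1ℚ ℚ.* d) ℚ.* q) ℚ.+
    ((((1ℚ ℚ.+ m) ℚ.+ m) ℚ.- 0ℚ) ℚ.- ♯ 2 ℚ.* d) ℚ.*
      ((1ℚ ℚ.+ 1ℚ ℚ.* (1ℚ ℚ.+ d)) ℚ.* q ℚ.+ (b ℚ.- 1ℚ ℚ.* (1ℚ ℚ.+ d)) ℚ.* r) ≡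
    (1ℚ ℚ.+ 1ℚ ℚ.* d) ℚ.* ((1ℚ ℚ.+ ♯ 2 ℚ.* d) ℚ.* p ℚ.+ (t ℚ.- ♯ 2 ℚ.* d) ℚ.* q) ℚ.+
    (m ℚ.- 1ℚ ℚ.* d) ℚ.* ((1ℚ ℚ.+ ♯ 2 ℚ.* (1ℚ ℚ.+ d)) ℚ.* q ℚ.+ (t ℚ.- ♯ 2 ℚ.* (1ℚ ℚ.+ d)) ℚ.* r)
  compare d m p q r refl = solve 5 (λ d m p q r →
    let one = con 1ℚ
        two = con (♯ 2)
        b = con ½ :* (((one :+ (one :+ m)) :+ (one :+ m)) :- one)
        t = con (♯ 3) :+ (m :+ m)
    in
    (one :+ two :* d) :* ((one :+ one :* d) :* p :+ (b :- one :* d) :* q) :+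
    ((((one :+ m) :+ m) :- con 0ℚ) :- two :* d) :*
      ((one :+ one :* (one :+ d)) :* q :+ (b :- one :* (one :+ d)) :* r) :=
    (one :+ one :* d) :* ((one :+ two :* d) :* p :+ (t :- two :* d) :* q) :+
    (m :- one :* d) :* ((one :+ two :* (one :+ d)) :* q :+ (t :- two :* (one :+ d)) :* r))
    refl d m p q r

-- The four polynomial identities

1+cx : ∀ c → const 1 + const c * x ≡ 1ℚ ∷ ♯ c ∷ []
1+cx c = cong₂ (λ a b → a ∷ b ∷ [])
  (solve 1 (λ c → con 1ℚ :+ (c :* con 0ℚ :+ con 0ℚ) := con 1ℚ) refl (fromℕ c))
  (trans (ℚ.*-identityʳ (fromℕ c)) (fromℕ≡♯ c))

1+3x+cx : ∀ c → const 1 + const 3 * x + const c * x ≡ 1ℚ ∷ ♯ (3 ℕ.+ c) ∷ []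
1+3x+cx c = cong₂ (λ a b → a ∷ b ∷ [])
  (solve 1 (λ c → con 1ℚ :+ (c :* con 0ℚ :+ con 0ℚ) := con 1ℚ) refl (fromℕ c))
  (trans (cong (♯ 3 ℚ.+_) (trans (ℚ.*-identityʳ (fromℕ c)) (fromℕ≡♯ c))) (sym (♯-+ 3 c)))

-- The conventions at n = 0 agree with the sums: `𝒞 0` consists of the empty word and `𝔇 0` of the
-- word 1, without descents. Hence n = 0 needs no separate argument.
P≡∑ : ∀ n → P n ≡ ∑x^ des (𝒞 n)
P≡∑ zero    = refl
P≡∑ (suc _) = refl

Q≡∑ : ∀ n → Q n ≡ ∑x^ des (𝔇 n)
Q≡∑ zero    = refl
Q≡∑ (suc _) = refl

S≡∑ : ∀ n → S n ≡ ∑x^ desB (𝒞± n)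
S≡∑ zero    = refl
S≡∑ (suc _) = refl

T≡∑ : ∀ n → T n ≡ ∑x^ desB (𝔇± n)
T≡∑ zero    = refl
T≡∑ (suc _) = refl

theorem4 : (n : ℕ) →
    (Q n ≈ (const 1 + const (2 ℕ.* n) * x) * P n + x * (const 1 - x) * P n ′)
    × (P (suc n) ≈ (const 1 + const n * x) * Q n + ½ · (x * (const 1 - x) * Q n ′))
    × (T n ≈ (const 1 + const (2 ℕ.* n) * x) * S n + x * (const 1 - x) * S n ′)
    × (S (suc n) ≈ (const 1 + const 3 * x + const (4 ℕ.* n) * x) * T n + const 2 * x * (const 1 - x) * T n ′)
theorem4 n =
    ∑x^-recurrence 1ℚ (♯ (2 ℕ.* n)) 1ℚ des (𝔇 n) des (𝒞 n) (∑-𝔇 n) (Q≡∑ n) (P≡∑ n) (1+cx (2 ℕ.* n)) refl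
  -- The factor ½ is first taken inside, where ½ x (1 - x) has the coefficient list 0, ½, -½ that
  -- the recurrence expects.
  , (λ k → trans
      (∑x^-recurrence 1ℚ (♯ n) ½ des (𝒞 (suc n)) des (𝔇 n) (∑-𝒞-suc n) {q = ½ · (x * (const 1 - x))}
        (P≡∑ (suc n)) (Q≡∑ n) (1+cx n) refl k)
      (scalar-inside k))
  , ∑x^-recurrence 1ℚ (♯ (2 ℕ.* n)) 1ℚ desB (𝔇± n) desB (𝒞± n) (∑-𝔇± n) (T≡∑ n) (S≡∑ n) (1+cx (2 ℕ.* n)) refl
  , ∑x^-recurrence 1ℚ (♯ (3 ℕ.+ 4 ℕ.* n)) (♯ 2) desB (𝒞± (suc n)) desB (𝔇± n) (∑-𝒞±-suc n)
      (S≡∑ (suc n)) (T≡∑ n) (1+3x+cx (4 ℕ.* n)) refl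
  where
  scalar-inside : (const 1 + const n * x) * Q n + (½ · (x * (const 1 - x))) * Q n ′
                ≈ (const 1 + const n * x) * Q n + ½ · (x * (const 1 - x) * Q n ′)
  scalar-inside k = begin
    coeff (p + (½ · q) * Q n ′) k              ≡⟨ coeff-+ p ((½ · q) * Q n ′) k ⟩
    coeff p k ℚ.+ coeff ((½ · q) * Q n ′) k    ≡⟨ cong (coeff p k ℚ.+_) (coeff-·* ½ q (Q n ′) k) ⟨
    coeff p k ℚ.+ coeff (½ · (q * Q n ′)) k    ≡⟨ coeff-+ p (½ · (q * Q n ′)) k ⟨
    coeff (p + ½ · (q * Q n ′)) k              ∎
    where
    p = (const 1 + const n * x) * Q n
    q = x * (const 1 - x)
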